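{- For every integer $k \geq 4$, the complement $\overline{C_{2k}}$ of the cycle on $2k$ vertices is a minimal non-UDG; that is, it is not a unit disk graph, but every proper induced subgraph of it is a unit disk graph.
   Context: All graphs are finite and simple. A graph $G=(V,E)$ is a unit disk graph (UDG) if there is a function $f:V\to\mathbb{R}^2$ such that for distinct $u,v\in V$, $uv\in E$ if and only if the Euclidean distance between $f(u)$ and $f(v)$ is at most $1$. $C_n$ is the chordless cycle on $n$ vertices and $\overline{G}$ denotes the complement of $G$. -}

module Defs where

open import Data.Fin as Fin using (Fin; zero; suc; toℕ)
open import Data.Fin.Subset using (Subset; inside; outside; ∣_∣; ⊤; _⊂_)
import Data.Integer as ℤ
import Data.Integer.Properties as ℤ
open import Data.Nat as ℕ using (ℕ; zero; suc)
import Data.Nat.Properties as ℕ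
open import Data.Product using (Σ-syntax; ∃-syntax; _×_; _,_; proj₁; proj₂)
open import Data.Rational as ℚ
  using (ℚ; mkℚ; 0ℚ; 1ℚ; ½; _+_; _-_; -_; _*_; _⊔_; _≤_; _<_)
import Data.Rational.Properties as ℚ
open import Data.Rational.Solver using (module +-*-Solver)
import Data.Rational.Unnormalised as ℚᵘ
import Data.Rational.Unnormalised.Properties as ℚᵘ
open import Data.Sum as Sum using (_⊎_; inj₁; inj₂)
open import Data.Vec using (_∷_)
open import Function using (_∘_; _⇔_)
open import Level using (0ℓ)
open import Relation.Binary.Core using (Rel)
open import Relation.Binary.Definitions using (Decidable; Symmetric; Irreflexive)
open import Relation.Binary.PropositionalEquality
open import Relation.Nullary using (¬_; Dec; yes; no; ¬?; _×-dec_; _⊎-dec_)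

IsCauchy : (ℕ → ℚ) → Set
IsCauchy x = ∀ ε → 0ℚ < ε →
  ∃[ N ] ∀ m n → N ℕ.≤ m → N ℕ.≤ n → ℚ.∣ x m - x n ∣ < ε

-- Two Cauchy sequences denote the same real number when their difference
-- tends to 0, i.e. when _≤ℝ_ holds in both directions.
record ℝ : Set where
  field
    seq    : ℕ → ℚ
    cauchy : IsCauchy seq

open ℝ public

infix 4 _≤ℝ_

_≤ℝ_ : Rel ℝ 0ℓ
x ≤ℝ y = ∀ ε → 0ℚ < ε → ∃[ N ] ∀ n → N ℕ.≤ n → seq x n ≤ seq y n + ε

-- For q ≥ 0, bisect q n is the n-th interval (l , h) of the bisection
-- started at (0 , 1 + q); it satisfies l² ≤ q < h².

halve : (q l h : ℚ) → Dec (½ * (l + h) * (½ * (l + h)) ≤ q) → ℚ × ℚ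
halve q l h (yes _) = ½ * (l + h) , h
halve q l h (no  _) = l , ½ * (l + h)

bisect : ℚ → ℕ → ℚ × ℚ
bisect q zero    = 0ℚ , 1ℚ + q
bisect q (suc n) =
  let l , h = bisect q n in
  halve q l h (½ * (l + h) * (½ * (l + h)) ℚ.≤? q)

√-seq : (ℕ → ℚ) → ℕ → ℚ
√-seq x n = proj₁ (bisect (x n ⊔ 0ℚ) n)

open +-*-Solver

<-step : ∀ {p q r} → p ≡ q → q < r → p < r
<-step refl q<r = q<r

half-pos : ∀ {ε} → 0ℚ < ε → 0ℚ < ½ * ε
half-pos {ε} 0<ε = ℚ.positive⁻¹ (½ * ε)
  {{ℚ.pos*pos⇒pos ½ ε {{ℚ.positive 0<ε}}}}

*-pos : ∀ {p q} → 0ℚ < p → 0ℚ < q → 0ℚ < p * q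
*-pos {p} {q} 0<p 0<q = ℚ.positive⁻¹ (p * q)
  {{ℚ.pos*pos⇒pos p {{ℚ.positive 0<p}} q {{ℚ.positive 0<q}}}}

halves : ∀ ε → ½ * ε + ½ * ε ≡ ε
halves = solve 1 (λ e → con ½ :* e :+ con ½ :* e := e) refl

shrink : ∀ {B ε} → 0ℚ < B → 0ℚ < ε → ∃[ η ] 0ℚ < η × B * η ≡ ½ * ε
shrink {B} {ε} 0<B 0<ε = η , η-pos , B*η
  where
  instance
    B-pos : ℚ.Positive B
    B-pos = ℚ.positive 0<B
    B-nonZero : ℚ.NonZero B
    B-nonZero = ℚ.pos⇒nonZero B
  η : ℚ
  η = ℚ.1/ B * (½ * ε)
  η-pos : 0ℚ < η
  η-pos = *-pos (ℚ.positive⁻¹ (ℚ.1/ B) {{ℚ.1/pos⇒pos B}}) (half-pos 0<ε)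
  B*η : B * η ≡ ½ * ε
  B*η = begin
    B * (ℚ.1/ B * (½ * ε)) ≡⟨ ℚ.*-assoc B (ℚ.1/ B) (½ * ε) ⟨
    B * ℚ.1/ B * (½ * ε)   ≡⟨ cong (_* (½ * ε)) (ℚ.*-inverseʳ B) ⟩
    1ℚ * (½ * ε)           ≡⟨ ℚ.*-identityˡ (½ * ε) ⟩
    ½ * ε                  ∎
    where open ≡-Reasoning

bounded : ∀ {x} → IsCauchy x →
          ∃[ B ] 0ℚ < B × ∃[ N ] ∀ n → N ℕ.≤ n → ℚ.∣ x n ∣ < B
bounded {x} cx with cx 1ℚ (ℚ.positive⁻¹ 1ℚ)
... | N , hN = 1ℚ + ℚ.∣ x N ∣ , B-pos , N , λ n N≤n → begin-strict
    ℚ.∣ x n ∣                     ≡⟨ cong ℚ.∣_∣ (solve 2 (λ a b → a := a :- b :+ b) refl (x n) (x N)) ⟩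
    ℚ.∣ x n - x N + x N ∣         ≤⟨ ℚ.∣p+q∣≤∣p∣+∣q∣ (x n - x N) (x N) ⟩
    ℚ.∣ x n - x N ∣ + ℚ.∣ x N ∣   <⟨ ℚ.+-monoˡ-< ℚ.∣ x N ∣ (hN n N N≤n ℕ.≤-refl) ⟩
    1ℚ + ℚ.∣ x N ∣                ∎
  where
  open ℚ.≤-Reasoning
  B-pos : 0ℚ < 1ℚ + ℚ.∣ x N ∣
  B-pos = ℚ.+-mono-<-≤ (ℚ.positive⁻¹ 1ℚ) (ℚ.0≤∣p∣ (x N))

*-bound : ∀ {a b A B} → 0ℚ < A → ℚ.∣ a ∣ < A → ℚ.∣ b ∣ < B → ℚ.∣ a * b ∣ < A * B
*-bound {a} {b} {A} {B} 0<A a<A b<B = begin-strict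
  ℚ.∣ a * b ∣       ≡⟨ ℚ.∣p*q∣≡∣p∣*∣q∣ a b ⟩
  ℚ.∣ a ∣ * ℚ.∣ b ∣ ≤⟨ ℚ.*-monoʳ-≤-nonNeg ℚ.∣ b ∣ {{ℚ.∣-∣-nonNeg b}} (ℚ.<⇒≤ a<A) ⟩
  A * ℚ.∣ b ∣       <⟨ ℚ.*-monoʳ-<-pos A {{ℚ.positive 0<A}} b<B ⟩
  A * B             ∎
  where open ℚ.≤-Reasoning

const-cauchy : ∀ q → IsCauchy (λ _ → q)
const-cauchy q ε 0<ε = 0 , λ _ _ _ _ →
  <-step (cong ℚ.∣_∣ (ℚ.+-inverseʳ q)) 0<ε

+-cauchy : ∀ {x y} → IsCauchy x → IsCauchy y → IsCauchy (λ n → x n + y n)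
+-cauchy {x} {y} cx cy ε 0<ε with cx (½ * ε) (half-pos 0<ε) | cy (½ * ε) (half-pos 0<ε)
... | M , hM | N , hN = M ℕ.⊔ N , λ m n p q → begin-strict
    ℚ.∣ x m + y m - (x n + y n) ∣         ≡⟨ cong ℚ.∣_∣ (lem (x m) (y m) (x n) (y n)) ⟩
    ℚ.∣ (x m - x n) + (y m - y n) ∣       ≤⟨ ℚ.∣p+q∣≤∣p∣+∣q∣ (x m - x n) (y m - y n) ⟩
    ℚ.∣ x m - x n ∣ + ℚ.∣ y m - y n ∣     <⟨ ℚ.+-mono-<
                                             (hM m n (ℕ.m⊔n≤o⇒m≤o M N p) (ℕ.m⊔n≤o⇒m≤o M N q))
                                             (hN m n (ℕ.m⊔n≤o⇒n≤o M N p) (ℕ.m⊔n≤o⇒n≤o M N q)) ⟩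
    ½ * ε + ½ * ε                         ≡⟨ halves ε ⟩
    ε                                     ∎
  where
  open ℚ.≤-Reasoning
  lem : ∀ a b c d → a + b - (c + d) ≡ (a - c) + (b - d)
  lem = solve 4 (λ a b c d → a :+ b :- (c :+ d) := (a :- c) :+ (b :- d)) refl

neg-cauchy : ∀ {x} → IsCauchy x → IsCauchy (λ n → - x n)
neg-cauchy {x} cx ε 0<ε with cx ε 0<ε
... | N , hN = N , λ m n p q → <-step
    (trans (cong ℚ.∣_∣ (lem (x m) (x n))) (ℚ.∣-p∣≡∣p∣ (x m - x n))) (hN m n p q)
  where
  lem : ∀ a b → - a - - b ≡ - (a - b)
  lem = solve 2 (λ a b → :- a :- (:- b) := :- (a :- b)) refl

*-diff : ∀ a b c d → a * b - c * d ≡ a * (b - d) + d * (a - c)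
*-diff = solve 4 (λ a b c d → a :* b :- c :* d := a :* (b :- d) :+ d :* (a :- c)) refl

*-diff-bound : ∀ {A B η θ ε} a b c d → 0ℚ < A → 0ℚ < B →
               ℚ.∣ a ∣ < A → ℚ.∣ d ∣ < B → ℚ.∣ b - d ∣ < η → ℚ.∣ a - c ∣ < θ →
               A * η ≡ ½ * ε → B * θ ≡ ½ * ε → ℚ.∣ a * b - c * d ∣ < ε
*-diff-bound {A} {B} {η} {θ} {ε} a b c d 0<A 0<B a<A d<B b-d a-c Aη Bθ = begin-strict
  ℚ.∣ a * b - c * d ∣                       ≡⟨ cong ℚ.∣_∣ (*-diff a b c d) ⟩
  ℚ.∣ a * (b - d) + d * (a - c) ∣           ≤⟨ ℚ.∣p+q∣≤∣p∣+∣q∣ (a * (b - d)) (d * (a - c)) ⟩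
  ℚ.∣ a * (b - d) ∣ + ℚ.∣ d * (a - c) ∣     <⟨ ℚ.+-mono-< left right ⟩
  ½ * ε + ½ * ε                             ≡⟨ halves ε ⟩
  ε                                         ∎
  where
  open ℚ.≤-Reasoning
  left : ℚ.∣ a * (b - d) ∣ < ½ * ε
  left = subst (ℚ.∣ a * (b - d) ∣ <_) Aη (*-bound {a} {b - d} 0<A a<A b-d)
  right : ℚ.∣ d * (a - c) ∣ < ½ * ε
  right = subst (ℚ.∣ d * (a - c) ∣ <_) Bθ (*-bound {d} {a - c} 0<B d<B a-c)

*-cauchy : ∀ {x y} → IsCauchy x → IsCauchy y → IsCauchy (λ n → x n * y n)
*-cauchy {x} {y} cx cy ε 0<ε = choose-bounds (bounded cx) (bounded cy)
  where
  Goal : Set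
  Goal = ∃[ N ] ∀ m n → N ℕ.≤ m → N ℕ.≤ n → ℚ.∣ x m * y m - x n * y n ∣ < ε
  Bounded Close : (ℕ → ℚ) → ℚ → ℕ → Set
  Bounded z B N = ∀ n → N ℕ.≤ n → ℚ.∣ z n ∣ < B
  Close z η N = ∀ m n → N ℕ.≤ m → N ℕ.≤ n → ℚ.∣ z m - z n ∣ < η

  choose-indices : ∀ {A B η θ} → 0ℚ < A → 0ℚ < B → A * η ≡ ½ * ε → B * θ ≡ ½ * ε →
                   ∃[ K ] Bounded x A K → ∃[ L ] Bounded y B L →
                   ∃[ M ] Close y η M → ∃[ N ] Close x θ N → Goal
  choose-indices 0<A 0<B Aη Bθ (K , hK) (L , hL) (M , hM) (N , hN) =
    (K ℕ.⊔ L) ℕ.⊔ (M ℕ.⊔ N) , λ m n p q →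
      *-diff-bound (x m) (y m) (x n) (y n) 0<A 0<B
        (hK m (toK p)) (hL n (toL q)) (hM m n (toM p) (toM q)) (hN m n (toN p) (toN q)) Aη Bθ
    where
    toK : ∀ {m} → (K ℕ.⊔ L) ℕ.⊔ (M ℕ.⊔ N) ℕ.≤ m → K ℕ.≤ m
    toK = ℕ.m⊔n≤o⇒m≤o K L ∘ ℕ.m⊔n≤o⇒m≤o (K ℕ.⊔ L) (M ℕ.⊔ N)
    toL : ∀ {m} → (K ℕ.⊔ L) ℕ.⊔ (M ℕ.⊔ N) ℕ.≤ m → L ℕ.≤ m
    toL = ℕ.m⊔n≤o⇒n≤o K L ∘ ℕ.m⊔n≤o⇒m≤o (K ℕ.⊔ L) (M ℕ.⊔ N)
    toM : ∀ {m} → (K ℕ.⊔ L) ℕ.⊔ (M ℕ.⊔ N) ℕ.≤ m → M ℕ.≤ m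
    toM = ℕ.m⊔n≤o⇒m≤o M N ∘ ℕ.m⊔n≤o⇒n≤o (K ℕ.⊔ L) (M ℕ.⊔ N)
    toN : ∀ {m} → (K ℕ.⊔ L) ℕ.⊔ (M ℕ.⊔ N) ℕ.≤ m → N ℕ.≤ m
    toN = ℕ.m⊔n≤o⇒n≤o M N ∘ ℕ.m⊔n≤o⇒n≤o (K ℕ.⊔ L) (M ℕ.⊔ N)

  choose-bounds : ∃[ A ] 0ℚ < A × ∃[ K ] Bounded x A K →
                  ∃[ B ] 0ℚ < B × ∃[ L ] Bounded y B L → Goal
  choose-bounds (A , 0<A , hA) (B , 0<B , hB) =
    let η , 0<η , Aη = shrink 0<A 0<ε
        θ , 0<θ , Bθ = shrink 0<B 0<ε
    in choose-indices 0<A 0<B Aη Bθ hA hB (cy η 0<η) (cx θ 0<θ)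

ι : ℕ → ℚ
ι n = ℚ.fromℚᵘ (ℚᵘ.mkℚᵘ (ℤ.+ n) 0)

ι-suc : ∀ n → ι (suc n) ≡ 1ℚ + ι n
ι-suc n = ℚ.toℚᵘ-injective (begin
  ℚ.toℚᵘ (ι (suc n))                         ≈⟨ ℚ.toℚᵘ-fromℚᵘ (ℚᵘ.mkℚᵘ (ℤ.+ suc n) 0) ⟩
  ℚᵘ.mkℚᵘ (ℤ.+ suc n) 0                      ≈⟨ ℚᵘ.*≡* (cong (ℤ._* ℤ.+ 1) (cong (ℤ._+_ (ℤ.+ 1)) (sym (ℤ.*-identityʳ (ℤ.+ n))))) ⟩
  ℚ.toℚᵘ 1ℚ ℚᵘ.+ ℚᵘ.mkℚᵘ (ℤ.+ n) 0           ≈⟨ ℚᵘ.+-congʳ (ℚ.toℚᵘ 1ℚ) (ℚᵘ.≃-sym (ℚ.toℚᵘ-fromℚᵘ (ℚᵘ.mkℚᵘ (ℤ.+ n) 0))) ⟩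
  ℚ.toℚᵘ 1ℚ ℚᵘ.+ ℚ.toℚᵘ (ι n)                ≈⟨ ℚᵘ.≃-sym (ℚ.toℚᵘ-homo-+ 1ℚ (ι n)) ⟩
  ℚ.toℚᵘ (1ℚ + ι n)                          ∎)
  where open ℚᵘ.≃-Reasoning

archimedean : ∀ q → ∃[ n ] q ≤ ι n
archimedean q@(mkℚ p d _) = ℤ.∣ p ∣ , ℚ.toℚᵘ-cancel-≤ (ℚᵘ.≤-respʳ-≃
  (ℚᵘ.≃-sym (ℚ.toℚᵘ-fromℚᵘ (ℚᵘ.mkℚᵘ (ℤ.+ ℤ.∣ p ∣) 0))) (ℚᵘ.*≤* (lem p)))
  where
  lem : ∀ i → i ℤ.* ℤ.+ 1 ℤ.≤ ℤ.+ ℤ.∣ i ∣ ℤ.* ℤ.+ suc d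
  lem (ℤ.+ n) = subst₂ ℤ._≤_ (ℤ.pos-* n 1) (ℤ.pos-* n (suc d))
    (ℤ.+≤+ (ℕ.*-monoʳ-≤ n (ℕ.s≤s ℕ.z≤n)))
  lem (ℤ.-[1+ n ]) = ℤ.-≤+

½^ : ℕ → ℚ
½^ zero    = 1ℚ
½^ (suc n) = ½ * ½^ n

½^-pos : ∀ n → 0ℚ < ½^ n
½^-pos zero    = ℚ.positive⁻¹ 1ℚ
½^-pos (suc n) = half-pos (½^-pos n)

½*-decr : ∀ {q} → 0ℚ < q → ½ * q ≤ q
½*-decr {q} 0<q = begin
  ½ * q         ≡⟨ ℚ.+-identityʳ (½ * q) ⟨
  ½ * q + 0ℚ    ≤⟨ ℚ.+-monoʳ-≤ (½ * q) (ℚ.<⇒≤ (half-pos 0<q)) ⟩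
  ½ * q + ½ * q ≡⟨ halves q ⟩
  q             ∎
  where open ℚ.≤-Reasoning

½^-anti : ∀ {m n} → m ℕ.≤′ n → ½^ n ≤ ½^ m
½^-anti (ℕ.≤′-reflexive refl) = ℚ.≤-refl
½^-anti {n = suc n} (ℕ.≤′-step p) = ℚ.≤-trans (½*-decr (½^-pos n)) (½^-anti p)

ι*½^<1 : ∀ n → ι n * ½^ n < 1ℚ
ι*½^<1 zero    = ℚ.positive⁻¹ 1ℚ
ι*½^<1 (suc n) = begin-strict
  ι (suc n) * (½ * ½^ n)        ≡⟨ cong (_* (½ * ½^ n)) (ι-suc n) ⟩
  (1ℚ + ι n) * (½ * ½^ n)       ≡⟨ lem (ι n) (½^ n) ⟩
  ½ * (½^ n + ι n * ½^ n)       <⟨ ℚ.*-monoʳ-<-pos ½ (ℚ.+-mono-≤-< (½^-anti (ℕ.≤⇒≤′ (ℕ.z≤n {n}))) (ι*½^<1 n)) ⟩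
  ½ * (1ℚ + 1ℚ)                 ≡⟨⟩
  1ℚ                            ∎
  where
  open ℚ.≤-Reasoning
  lem : ∀ a h → (1ℚ + a) * (½ * h) ≡ ½ * (h + a * h)
  lem = solve 2 (λ a h → (con 1ℚ :+ a) :* (con ½ :* h) := con ½ :* (h :+ a :* h)) refl

small : ∀ {c δ} → 0ℚ < c → 0ℚ < δ → ∃[ N ] ∀ n → N ℕ.≤ n → c * ½^ n < δ
small {c} {δ} 0<c 0<δ = N , λ n N≤n → begin-strict
    c * ½^ n            ≤⟨ ℚ.*-monoˡ-≤-nonNeg c {{ℚ.pos⇒nonNeg c {{ℚ.positive 0<c}}}} (½^-anti (ℕ.≤⇒≤′ N≤n)) ⟩
    c * ½^ N            ≡⟨ cong (_* ½^ N) c≡ ⟩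
    δ * r * ½^ N        ≡⟨ ℚ.*-assoc δ r (½^ N) ⟩
    δ * (r * ½^ N)      ≤⟨ ℚ.*-monoˡ-≤-nonNeg δ {{ℚ.pos⇒nonNeg δ}} (ℚ.*-monoʳ-≤-nonNeg (½^ N) {{ℚ.pos⇒nonNeg (½^ N) {{ℚ.positive (½^-pos N)}}}} r≤) ⟩
    δ * (ι N * ½^ N)    <⟨ ℚ.*-monoʳ-<-pos δ (ι*½^<1 N) ⟩
    δ * 1ℚ              ≡⟨ ℚ.*-identityʳ δ ⟩
    δ                   ∎
  where
  open ℚ.≤-Reasoning
  instance
    δ-pos : ℚ.Positive δ
    δ-pos = ℚ.positive 0<δ
    δ-nonZero : ℚ.NonZero δ
    δ-nonZero = ℚ.pos⇒nonZero δ
  r : ℚ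
  r = ℚ.1/ δ * c
  N : ℕ
  N = proj₁ (archimedean r)
  r≤ : r ≤ ι N
  r≤ = proj₂ (archimedean r)
  c≡ : c ≡ δ * r
  c≡ = sym (trans (sym (ℚ.*-assoc δ (ℚ.1/ δ) c))
         (trans (cong (_* c) (ℚ.*-inverseʳ δ)) (ℚ.*-identityˡ c)))

record Bracket (q l h : ℚ) : Set where
  field
    0≤l  : 0ℚ ≤ l
    l≤h  : l ≤ h
    l²≤q : l * l ≤ q
    q<h² : q < h * h

open Bracket

halve-bracket : ∀ {q l h} d → Bracket q l h →
                Bracket q (proj₁ (halve q l h d)) (proj₂ (halve q l h d))
halve-bracket {q} {l} {h} d b = by d
  where
  l≤m : l ≤ ½ * (l + h)
  l≤m = begin
    l           ≡⟨ solve 1 (λ l → l := con ½ :* (l :+ l)) refl l ⟩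
    ½ * (l + l) ≤⟨ ℚ.*-monoˡ-≤-nonNeg ½ (ℚ.+-monoʳ-≤ l (l≤h b)) ⟩
    ½ * (l + h) ∎
    where open ℚ.≤-Reasoning
  m≤h : ½ * (l + h) ≤ h
  m≤h = begin
    ½ * (l + h) ≤⟨ ℚ.*-monoˡ-≤-nonNeg ½ (ℚ.+-monoˡ-≤ h (l≤h b)) ⟩
    ½ * (h + h) ≡⟨ solve 1 (λ h → con ½ :* (h :+ h) := h) refl h ⟩
    h           ∎
    where open ℚ.≤-Reasoning
  by : ∀ d → Bracket q (proj₁ (halve q l h d)) (proj₂ (halve q l h d))
  by (yes m²≤q) = record
    { 0≤l = ℚ.≤-trans (0≤l b) l≤m ; l≤h = m≤h ; l²≤q = m²≤q ; q<h² = q<h² b }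
  by (no m²≰q) = record
    { 0≤l = 0≤l b ; l≤h = l≤m ; l²≤q = l²≤q b ; q<h² = ℚ.≰⇒> m²≰q }

halve-width : ∀ q l h d → let l′ , h′ = halve q l h d in h′ - l′ ≡ ½ * (h - l)
halve-width q l h (yes _) =
  solve 2 (λ l h → h :- con ½ :* (l :+ h) := con ½ :* (h :- l)) refl l h
halve-width q l h (no  _) =
  solve 2 (λ l h → con ½ :* (l :+ h) :- l := con ½ :* (h :- l)) refl l h

bisect-bracket : ∀ {q} → 0ℚ ≤ q → ∀ n →
                 Bracket q (proj₁ (bisect q n)) (proj₂ (bisect q n))
bisect-bracket {q} 0≤q zero = record
  { 0≤l  = ℚ.≤-refl
  ; l≤h  = ℚ.<⇒≤ (ℚ.+-mono-<-≤ (ℚ.positive⁻¹ 1ℚ) 0≤q)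
  ; l²≤q = 0≤q
  ; q<h² = begin-strict
      q                      ≡⟨ ℚ.+-identityʳ q ⟨
      q + 0ℚ                 <⟨ ℚ.+-monoʳ-< q (ℚ.+-mono-<-≤ (ℚ.positive⁻¹ 1ℚ) (ℚ.+-mono-≤ 0≤q 0≤q*q)) ⟩
      q + (1ℚ + (q + q * q)) ≡⟨ solve 1 (λ q → q :+ (con 1ℚ :+ (q :+ q :* q))
                                   := (con 1ℚ :+ q) :* (con 1ℚ :+ q)) refl q ⟩
      (1ℚ + q) * (1ℚ + q)    ∎
  }
  where
  open ℚ.≤-Reasoning
  0≤q*q : 0ℚ ≤ q * q
  0≤q*q = ℚ.nonNegative⁻¹ (q * q)
    {{ℚ.nonNeg*nonNeg⇒nonNeg q {{ℚ.nonNegative 0≤q}} q {{ℚ.nonNegative 0≤q}}}}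
bisect-bracket {q} 0≤q (suc n) =
  let l , h = bisect q n in
  halve-bracket {q} {l} {h} (½ * (l + h) * (½ * (l + h)) ℚ.≤? q) (bisect-bracket 0≤q n)

bisect-width : ∀ q n → proj₂ (bisect q n) - proj₁ (bisect q n) ≡ (1ℚ + q) * ½^ n
bisect-width q zero = solve 1 (λ q → con 1ℚ :+ q :- con 0ℚ := (con 1ℚ :+ q) :* con 1ℚ) refl q
bisect-width q (suc n) =
  let l , h = bisect q n in
  trans (halve-width q l h (½ * (l + h) * (½ * (l + h)) ℚ.≤? q))
  (trans (cong (½ *_) (bisect-width q n))
    (solve 2 (λ a b → con ½ :* (a :* b) := a :* (con ½ :* b)) refl (1ℚ + q) (½^ n)))

*-mono-≤-nonNeg : ∀ {a b} → 0ℚ ≤ a → a ≤ b → a * a ≤ b * b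
*-mono-≤-nonNeg {a} {b} 0≤a a≤b = ℚ.≤-trans
  (ℚ.*-monoˡ-≤-nonNeg a {{ℚ.nonNegative 0≤a}} a≤b)
  (ℚ.*-monoʳ-≤-nonNeg b {{ℚ.nonNegative (ℚ.≤-trans 0≤a a≤b)}} a≤b)

diff⇒≤ : ∀ {a b r} → ℚ.∣ a - b ∣ < r → a ≤ b + r
diff⇒≤ {a} {b} {r} p = begin
  a               ≡⟨ solve 2 (λ a b → a := b :+ (a :- b)) refl a b ⟩
  b + (a - b)     ≤⟨ ℚ.+-monoʳ-≤ b (p≤∣p∣ (a - b)) ⟩
  b + ℚ.∣ a - b ∣ ≤⟨ ℚ.+-monoʳ-≤ b (ℚ.<⇒≤ p) ⟩
  b + r           ∎
  where
  open ℚ.≤-Reasoning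
  p≤∣p∣ : ∀ p → p ≤ ℚ.∣ p ∣
  p≤∣p∣ p with ℚ.≤-total 0ℚ p
  ... | inj₁ 0≤p = ℚ.≤-reflexive (sym (ℚ.0≤p⇒∣p∣≡p 0≤p))
  ... | inj₂ p≤0 = ℚ.≤-trans p≤0 (ℚ.0≤∣p∣ p)

⊔-shift : ∀ {a b r} → 0ℚ < r → a ≤ b + r → a ⊔ 0ℚ ≤ (b ⊔ 0ℚ) + r
⊔-shift {a} {b} {r} 0<r p = ℚ.⊔-lub
  (ℚ.≤-trans p (ℚ.+-monoˡ-≤ r (ℚ.p≤p⊔q b 0ℚ)))
  (ℚ.+-mono-≤ (ℚ.p≤q⊔p b 0ℚ) (ℚ.<⇒≤ 0<r))

<⇒diff : ∀ {a b r} → a < b + r → b < a + r → ℚ.∣ a - b ∣ < r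
<⇒diff {a} {b} {r} p q with ℚ.∣p∣≡p∨∣p∣≡-p (a - b)
... | inj₁ e = <-step e (begin-strict
    a - b       <⟨ ℚ.+-monoˡ-< (- b) p ⟩
    b + r - b   ≡⟨ solve 2 (λ b r → b :+ r :- b := r) refl b r ⟩
    r           ∎)
  where open ℚ.≤-Reasoning
... | inj₂ e = <-step e (begin-strict
    - (a - b)   ≡⟨ solve 2 (λ a b → :- (a :- b) := b :- a) refl a b ⟩
    b - a       <⟨ ℚ.+-monoˡ-< (- a) q ⟩
    a + r - a   ≡⟨ solve 2 (λ b r → b :+ r :- b := r) refl a r ⟩
    r           ∎)
  where open ℚ.≤-Reasoning

root-close : ∀ {q q′ l l′ h h′ δ} → Bracket q l h → Bracket q′ l′ h′ → 0ℚ < δ →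
             h - l < δ → q′ ≤ q + δ * δ → l′ < l + (δ + δ)
root-close {q} {q′} {l} {l′} {h} {h′} {δ} b b′ 0<δ w c = ℚ.≰⇒> λ l+2δ≤l′ →
  ℚ.<-irrefl refl (begin-strict
    (l + (δ + δ)) * (l + (δ + δ))           ≤⟨ *-mono-≤-nonNeg (ℚ.+-mono-≤ (0≤l b) (ℚ.+-mono-≤ 0≤δ 0≤δ)) l+2δ≤l′ ⟩
    l′ * l′                                 ≤⟨ l²≤q b′ ⟩
    q′                                      ≤⟨ c ⟩
    q + δ * δ                               <⟨ ℚ.+-monoˡ-< (δ * δ) (q<h² b) ⟩
    h * h + δ * δ                           ≤⟨ ℚ.+-monoˡ-≤ (δ * δ) (*-mono-≤-nonNeg (ℚ.≤-trans (0≤l b) (l≤h b)) h≤l+δ) ⟩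
    (l + δ) * (l + δ) + δ * δ               ≡⟨ ℚ.+-identityʳ _ ⟨
    (l + δ) * (l + δ) + δ * δ + 0ℚ          ≤⟨ ℚ.+-monoʳ-≤ ((l + δ) * (l + δ) + δ * δ) 0≤rest ⟩
    (l + δ) * (l + δ) + δ * δ + (l + l + (δ + δ)) * δ
                                            ≡⟨ solve 2 (λ l d → (l :+ d) :* (l :+ d) :+ d :* d :+ (l :+ l :+ (d :+ d)) :* d
                                                 := (l :+ (d :+ d)) :* (l :+ (d :+ d))) refl l δ ⟩
    (l + (δ + δ)) * (l + (δ + δ))           ∎)
  where
  open ℚ.≤-Reasoning
  0≤δ : 0ℚ ≤ δ
  0≤δ = ℚ.<⇒≤ 0<δ
  0≤rest : 0ℚ ≤ (l + l + (δ + δ)) * δ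
  0≤rest = ℚ.nonNegative⁻¹ _ {{ℚ.nonNeg*nonNeg⇒nonNeg (l + l + (δ + δ))
    {{ℚ.nonNegative (ℚ.+-mono-≤ (ℚ.+-mono-≤ (0≤l b) (0≤l b)) (ℚ.+-mono-≤ 0≤δ 0≤δ))}}
    δ {{ℚ.nonNegative 0≤δ}}}}
  h≤l+δ : h ≤ l + δ
  h≤l+δ = begin
    h           ≡⟨ solve 2 (λ h l → h := l :+ (h :- l)) refl h l ⟩
    l + (h - l) ≤⟨ ℚ.+-monoʳ-≤ l (ℚ.<⇒≤ w) ⟩
    l + δ       ∎

√-cauchy : ∀ {x} → IsCauchy x → IsCauchy (√-seq x)
√-cauchy {x} cx ε 0<ε = choose-bound (bounded cx)
  where
  δ : ℚ
  δ = ½ * ε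
  0<δ : 0ℚ < δ
  0<δ = half-pos 0<ε
  x⁺ : ℕ → ℚ
  x⁺ n = x n ⊔ 0ℚ
  bracket : ∀ n → Bracket (x⁺ n) (proj₁ (bisect (x⁺ n) n)) (proj₂ (bisect (x⁺ n) n))
  bracket n = bisect-bracket (ℚ.p≤q⊔p (x n) 0ℚ) n
  Goal : Set
  Goal = ∃[ N ] ∀ m n → N ℕ.≤ m → N ℕ.≤ n → ℚ.∣ √-seq x m - √-seq x n ∣ < ε

  choose-indices : ∀ {B} → 0ℚ < B →
                   ∃[ K ] (∀ n → K ℕ.≤ n → ℚ.∣ x n ∣ < B) →
                   ∃[ M ] (∀ n → M ℕ.≤ n → (1ℚ + B) * ½^ n < δ) →
                   ∃[ N ] (∀ m n → N ℕ.≤ m → N ℕ.≤ n → ℚ.∣ x m - x n ∣ < δ * δ) → Goal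
  choose-indices {B} 0<B (K , hK) (M , hM) (N , hN) =
    K ℕ.⊔ (M ℕ.⊔ N) , λ m n p q → <⇒diff (close n m q p) (close m n p q)
    where
    P : ℕ → Set
    P n = K ℕ.⊔ (M ℕ.⊔ N) ℕ.≤ n
    toK : ∀ {n} → P n → K ℕ.≤ n
    toK = ℕ.m⊔n≤o⇒m≤o K (M ℕ.⊔ N)
    toM : ∀ {n} → P n → M ℕ.≤ n
    toM = ℕ.m⊔n≤o⇒m≤o M N ∘ ℕ.m⊔n≤o⇒n≤o K (M ℕ.⊔ N)
    toN : ∀ {n} → P n → N ℕ.≤ n
    toN = ℕ.m⊔n≤o⇒n≤o M N ∘ ℕ.m⊔n≤o⇒n≤o K (M ℕ.⊔ N)
    x⁺≤B : ∀ n → P n → x⁺ n ≤ B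
    x⁺≤B n p = ℚ.⊔-lub
      (subst (x n ≤_) (ℚ.+-identityˡ B) (diff⇒≤ {x n} {0ℚ} (<-step (cong ℚ.∣_∣ (ℚ.+-identityʳ (x n))) (hK n (toK p)))))
      (ℚ.<⇒≤ 0<B)
    width : ∀ n → P n → proj₂ (bisect (x⁺ n) n) - proj₁ (bisect (x⁺ n) n) < δ
    width n p = <-step (bisect-width (x⁺ n) n) (ℚ.≤-<-trans
      (ℚ.*-monoʳ-≤-nonNeg (½^ n) {{ℚ.pos⇒nonNeg (½^ n) {{ℚ.positive (½^-pos n)}}}}
        (ℚ.+-monoʳ-≤ 1ℚ (x⁺≤B n p)))
      (hM n (toM p)))
    close : ∀ m n → P m → P n → √-seq x n < √-seq x m + ε
    close m n p q = subst (λ e → √-seq x n < √-seq x m + e) (halves ε)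
      (root-close (bracket m) (bracket n) 0<δ (width m p)
        (⊔-shift {x n} {x m} (*-pos 0<δ 0<δ) (diff⇒≤ {x n} {x m} (hN n m (toN q) (toN p)))))

  choose-bound : ∃[ B ] 0ℚ < B × ∃[ K ] (∀ n → K ℕ.≤ n → ℚ.∣ x n ∣ < B) → Goal
  choose-bound (B , 0<B , hB) = choose-indices 0<B hB
    (small (ℚ.+-mono-< (ℚ.positive⁻¹ 1ℚ) 0<B) 0<δ) (cx (δ * δ) (*-pos 0<δ 0<δ))

infixl 6 _+ℝ_ _-ℝ_
infixl 7 _*ℝ_
infix  8 -ℝ_

fromℚ : ℚ → ℝ
fromℚ q = record { seq = λ _ → q ; cauchy = const-cauchy q }

1ℝ : ℝ
1ℝ = fromℚ 1ℚ

_+ℝ_ : ℝ → ℝ → ℝ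
x +ℝ y = record { seq = λ n → seq x n + seq y n ; cauchy = +-cauchy {seq x} {seq y} (cauchy x) (cauchy y) }

_*ℝ_ : ℝ → ℝ → ℝ
x *ℝ y = record { seq = λ n → seq x n * seq y n ; cauchy = *-cauchy {seq x} {seq y} (cauchy x) (cauchy y) }

-ℝ_ : ℝ → ℝ
-ℝ x = record { seq = λ n → - seq x n ; cauchy = neg-cauchy {seq x} (cauchy x) }

_-ℝ_ : ℝ → ℝ → ℝ
x -ℝ y = x +ℝ (-ℝ y)

-- The square root of max x 0.
√_ : ℝ → ℝ
√ x = record { seq = √-seq (seq x) ; cauchy = √-cauchy {seq x} (cauchy x) }

Point : Set
Point = ℝ × ℝ

dist : Point → Point → ℝ
dist (x , y) (x′ , y′) = √ ((x -ℝ x′) *ℝ (x -ℝ x′) +ℝ (y -ℝ y′) *ℝ (y -ℝ y′))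

-- A simple graph with vertex set Fin n. Decidability of adjacency, automatic
-- classically, makes complement an involution.
record Graph (n : ℕ) : Set₁ where
  infix 4 _~_ _~?_
  field
    _~_      : Rel (Fin n) 0ℓ
    _~?_     : Decidable _~_
    ~-sym    : Symmetric _~_
    ~-irrefl : Irreflexive _≡_ _~_

complement : ∀ {n} → Graph n → Graph n
complement G = record
  { _~_      = λ u v → u ≢ v × ¬ u ~ v
  ; _~?_     = λ u v → ¬? (u Fin.≟ v) ×-dec ¬? (u ~? v)
  ; ~-sym    = λ (u≢v , u≁v) → u≢v ∘ sym , u≁v ∘ ~-sym
  ; ~-irrefl = λ u≡v (u≢v , _) → u≢v u≡v
  }
  where open Graph G

-- v follows u in the cyclic order 0, 1, …, n - 1, 0.
Next : ∀ {n} → Fin n → Fin n → Set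
Next {n} u v = suc (toℕ u) ≡ toℕ v ⊎ (suc (toℕ u) ≡ n × toℕ v ≡ 0)

next? : ∀ {n} (u v : Fin n) → Dec (Next u v)
next? {n} u v =
  (suc (toℕ u) ℕ.≟ toℕ v) ⊎-dec ((suc (toℕ u) ℕ.≟ n) ×-dec (toℕ v ℕ.≟ 0))

-- The cycle Cₙ for n ≥ 3. The condition u ≢ v matters only for n = 1,
-- where it excludes a loop.
cycle : (n : ℕ) → Graph n
cycle n = record
  { _~_      = λ u v → u ≢ v × (Next u v ⊎ Next v u)
  ; _~?_     = λ u v → ¬? (u Fin.≟ v) ×-dec (next? u v ⊎-dec next? v u)
  ; ~-sym    = λ (u≢v , e) → u≢v ∘ sym , Sum.swap e
  ; ~-irrefl = λ u≡v (u≢v , _) → u≢v u≡v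
  }

-- The increasing enumeration of the elements of S.
element : ∀ {n} (S : Subset n) → Fin ∣ S ∣ → Fin n
element (outside ∷ S) i       = suc (element S i)
element (inside  ∷ S) zero    = zero
element (inside  ∷ S) (suc i) = suc (element S i)

-- The subgraph of G induced by S, with the elements of S renumbered
-- in increasing order.
induced : ∀ {n} → Graph n → (S : Subset n) → Graph ∣ S ∣
induced G S = record
  { _~_      = λ i j → element S i ~ element S j
  ; _~?_     = λ i j → element S i ~? element S j
  ; ~-sym    = ~-sym
  ; ~-irrefl = λ i≡j → ~-irrefl (cong (element S) i≡j)
  }
  where open Graph G

IsUDG : ∀ {n} → Graph n → Set
IsUDG {n} G = Σ[ f ∈ (Fin n → Point) ]
  ∀ u v → u ≢ v → (u ~ v ⇔ dist (f u) (f v) ≤ℝ 1ℝ)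
  where open Graph G

IsMinimalNonUDG : ∀ {n} → Graph n → Set
IsMinimalNonUDG G = ¬ IsUDG G × (∀ S → S ⊂ ⊤ → IsUDG (induced G S))

{-# OPTIONS --safe #-}

-- Not a unit disk graph: if ab and cd are longer than 1 while ac, ad, bc, bd
-- are not, then the segments ab and cd cross. Along the cycle p₀ p₁ … this
-- makes the sign of (pᵢ₊₁ - pᵢ) × (pⱼ₊₁ - pⱼ) flip whenever i or j moves by one
-- and the edges stay at cyclic distance at least 3. For even n ≥ 8 one can walk
-- from (0 , 3) to (3 , n) = (3 , 0) by n such moves, so the sign at (0 , 3) equals
-- that at (3 , 0), contradicting antisymmetry. The argument runs on rational
-- points: the strict inequalities leave room to approximate.
--
-- Minimality: deleting a vertex leaves the complement of a path. Its i-th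
-- vertex is drawn at (η²i² , ηi) for even i and at (1 + 2η² - η²i² , -ηi) for
-- odd i; for i and j of different parity the squared distance is
-- 1 + η²(4 - (i - j)²) + O(η⁴), which exceeds 1 exactly when |i - j| = 1.

module Submission where

open import Defs
open import Data.Bool as Bool using (Bool; true; false; not)
open import Data.Bool.Properties using (not-involutive; not-¬; ¬-not)
open import Data.Empty using (⊥; ⊥-elim)
open import Data.Fin as Fin using (Fin; zero; suc; toℕ)
import Data.Fin.Properties as Fin
open import Data.Fin.Subset using (Subset; inside; outside; _∈_; _⊂_; ⊤)
open import Data.Nat as ℕ using (ℕ; zero; suc; _%_; _/_)
import Data.Nat.DivMod as ℕ
open import Data.Nat.DivMod using (_mod_)
import Data.Nat.Properties as ℕ
open import Data.Product using (_×_; _,_; proj₁; proj₂; ∃; ∃-syntax; swap)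
open import Data.Rational as ℚ using (ℚ; 0ℚ; 1ℚ; ½; _+_; _-_; -_; _*_; _⊔_; _≤_; _<_)
import Data.Rational.Properties as ℚ
open import Data.Rational.Solver using (module +-*-Solver)
open import Data.Sum using (_⊎_; inj₁; inj₂)
open import Data.Vec.Base using (_∷_; here; there)
open import Function using (_∘_; Equivalence; mk⇔)
open import Relation.Binary.Definitions using (tri<; tri≈; tri>)
open import Relation.Binary.PropositionalEquality
  using (_≡_; _≢_; refl; sym; trans; cong; cong₂; subst; subst₂; module ≡-Reasoning)
open import Relation.Nullary using (¬_; yes; no; does)
open import Relation.Nullary.Decidable using (dec-true; dec-false; decidable-stable)

open +-*-Solver
open Bracket

-- Plane vectors over the rationals and the polynomial identities of the crossing argument.

infixl 6 _⊖_ _⊖ₑ_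
infix 8 _∧_
infix 9 _∧ₑ_

Vector : Set
Vector = ℚ × ℚ

_⊖_ : Vector → Vector → Vector
(x , y) ⊖ (x′ , y′) = x - x′ , y - y′

_∧_ : Vector → Vector → ℚ
(x , y) ∧ (x′ , y′) = x * y′ - y * x′

∥_∥² : Vector → ℚ
∥ x , y ∥² = x * x + y * y

0<q-p : ∀ {p q} → p < q → 0ℚ < q - p
0<q-p {p} {q} p<q = <-step (sym (ℚ.+-inverseʳ p)) (ℚ.+-monoˡ-< (- p) p<q)

0≤*0≤ : ∀ {p q} → 0ℚ ≤ p → 0ℚ ≤ q → 0ℚ ≤ p * q
0≤*0≤ {p} {q} 0≤p 0≤q = ℚ.nonNegative⁻¹ _
  {{ℚ.nonNeg*nonNeg⇒nonNeg p {{ℚ.nonNegative 0≤p}} q {{ℚ.nonNegative 0≤q}}}}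

0≤p² : ∀ p → 0ℚ ≤ p * p
0≤p² p with ℚ.≤-total 0ℚ p
... | inj₁ 0≤p = 0≤*0≤ 0≤p 0≤p
... | inj₂ p≤0 = subst (0ℚ ≤_) (solve 1 (λ p → :- p :* :- p := p :* p) refl p)
                   (0≤*0≤ (ℚ.neg-antimono-≤ p≤0) (ℚ.neg-antimono-≤ p≤0))

0≤∥∥² : ∀ v → 0ℚ ≤ ∥ v ∥²
0≤∥∥² (x , y) = ℚ.+-mono-≤ (0≤p² x) (0≤p² y)

_∧ₑ_ : ∀ {n} → Polynomial n × Polynomial n → Polynomial n × Polynomial n → Polynomial n
(x , y) ∧ₑ (x′ , y′) = x :* y′ :- y :* x′

_⊖ₑ_ : ∀ {n} → Polynomial n × Polynomial n → Polynomial n × Polynomial n → Polynomial n × Polynomial n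
(x , y) ⊖ₑ (x′ , y′) = x :- x′ , y :- y′

∥_∥ₑ : ∀ {n} → Polynomial n × Polynomial n → Polynomial n
∥ x , y ∥ₑ = x :* x :+ y :* y

-- An affine functional is applied to the dependency (u ∧ w) v = (u ∧ v) w + (v ∧ w) u,
-- whose weights sum to zero once 0 gets weight u ∧ v + v ∧ w - u ∧ w. Here it is the
-- sum of the bisector functionals of u, v and of w, 0, which separates {0, v} from {u, w}.
separating-line : ∀ u v w →
  (u ∧ v + v ∧ w - u ∧ w) * (∥ u ∥² - ∥ v ∥² + ∥ w ∥²)
    + u ∧ w * (∥ u ⊖ v ∥² + (∥ v ⊖ w ∥² - ∥ v ∥²))
    + u ∧ v * (∥ v ⊖ w ∥² - ∥ u ⊖ w ∥² + ∥ w ∥²)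
    + v ∧ w * (∥ u ⊖ v ∥² + (∥ u ∥² - ∥ u ⊖ w ∥²)) ≡ 0ℚ
separating-line (a , b) (c , d) (e , f) = solve 6 (λ a b c d e f →
  let u = a , b ; v = c , d ; w = e , f in
  (u ∧ₑ v :+ v ∧ₑ w :- u ∧ₑ w) :* (∥ u ∥ₑ :- ∥ v ∥ₑ :+ ∥ w ∥ₑ)
    :+ u ∧ₑ w :* (∥ u ⊖ₑ v ∥ₑ :+ (∥ v ⊖ₑ w ∥ₑ :- ∥ v ∥ₑ))
    :+ u ∧ₑ v :* (∥ v ⊖ₑ w ∥ₑ :- ∥ u ⊖ₑ w ∥ₑ :+ ∥ w ∥ₑ)
    :+ v ∧ₑ w :* (∥ u ⊖ₑ v ∥ₑ :+ (∥ u ∥ₑ :- ∥ u ⊖ₑ w ∥ₑ)) := con 0ℚ) refl a b c d e f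

-- The same for twice the inner product with w - v, taken from v.
separating-vertex : ∀ u v w →
  u ∧ v * (∥ v ⊖ w ∥² + ∥ v ⊖ w ∥²)
    + v ∧ w * (∥ u ⊖ v ∥² + (∥ v ⊖ w ∥² - ∥ u ⊖ w ∥²))
    + (u ∧ w - (u ∧ v + v ∧ w)) * (∥ v ∥² + (∥ v ⊖ w ∥² - ∥ w ∥²)) ≡ 0ℚ
separating-vertex (a , b) (c , d) (e , f) = solve 6 (λ a b c d e f →
  let u = a , b ; v = c , d ; w = e , f in
  u ∧ₑ v :* (∥ v ⊖ₑ w ∥ₑ :+ ∥ v ⊖ₑ w ∥ₑ)
    :+ v ∧ₑ w :* (∥ u ⊖ₑ v ∥ₑ :+ (∥ v ⊖ₑ w ∥ₑ :- ∥ u ⊖ₑ w ∥ₑ))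
    :+ (u ∧ₑ w :- (u ∧ₑ v :+ v ∧ₑ w)) :* (∥ v ∥ₑ :+ (∥ v ⊖ₑ w ∥ₑ :- ∥ w ∥ₑ)) := con 0ℚ)
  refl a b c d e f

-- Eight times Lagrange's identity for `u` and `w ⊖ v`. As `s - t` is twice their inner product, the
-- left side is 8PQ - 2(s - t)², arranged in factors whose signs can be read off.
lagrange : ∀ u v w →
  let P = ∥ u ∥² ; Q = ∥ v ⊖ w ∥² ; s = ∥ w ∥² + ∥ u ⊖ v ∥² ; t = ∥ v ∥² + ∥ u ⊖ w ∥² in
  ((P + P - s) + t) * ((Q + Q - t) + s) + ((P + P - t) + s) * ((Q + Q - s) + t)
    ≡ (1ℚ + 1ℚ) * (1ℚ + 1ℚ) * (1ℚ + 1ℚ) * ((u ∧ w - u ∧ v) * (u ∧ w - u ∧ v))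
lagrange (a , b) (c , d) (e , f) = solve 6 (λ a b c d e f →
  let u = a , b ; v = c , d ; w = e , f
      P = ∥ u ∥ₑ ; Q = ∥ v ⊖ₑ w ∥ₑ ; s = ∥ w ∥ₑ :+ ∥ u ⊖ₑ v ∥ₑ ; t = ∥ v ∥ₑ :+ ∥ u ⊖ₑ w ∥ₑ
  in
  ((P :+ P :- s) :+ t) :* ((Q :+ Q :- t) :+ s) :+ ((P :+ P :- t) :+ s) :* ((Q :+ Q :- s) :+ t)
    := con (1ℚ + 1ℚ) :* con (1ℚ + 1ℚ) :* con (1ℚ + 1ℚ) :* ((u ∧ₑ w :- u ∧ₑ v) :* (u ∧ₑ w :- u ∧ₑ v)))
  refl a b c d e f

0≤q-p : ∀ {p q} → p ≤ q → 0ℚ ≤ q - p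
0≤q-p {p} {q} p≤q = subst (_≤ q - p) (ℚ.+-inverseʳ p) (ℚ.+-monoˡ-≤ (- p) p≤q)

-- Two long segments with short connections cross.

Opposite : ℚ → ℚ → Set
Opposite p q = (p < 0ℚ × 0ℚ < q) ⊎ (0ℚ < p × q < 0ℚ)

∥⊖∥²-comm : ∀ u v → ∥ u ⊖ v ∥² ≡ ∥ v ⊖ u ∥²
∥⊖∥²-comm (a , b) (c , d) = solve 4 (λ a b c d →
  ∥ (a , b) ⊖ₑ (c , d) ∥ₑ := ∥ (c , d) ⊖ₑ (a , b) ∥ₑ) refl a b c d

∥swap∥² : ∀ u → ∥ swap u ∥² ≡ ∥ u ∥²
∥swap∥² (x , y) = ℚ.+-comm (y * y) (x * x)

∧-swap : ∀ u v → swap u ∧ swap v ≡ - (u ∧ v)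
∧-swap (a , b) (c , d) =
  solve 4 (λ a b c d → (b , a) ∧ₑ (d , c) := :- ((a , b) ∧ₑ (c , d))) refl a b c d

∧-antisym : ∀ u v → u ∧ v ≡ - (v ∧ u)
∧-antisym (a , b) (c , d) =
  solve 4 (λ a b c d → (a , b) ∧ₑ (c , d) := :- ((c , d) ∧ₑ (a , b))) refl a b c d

-- A crossing with one point moved to the origin: the long segments join 0 to `u` and `v` to `w`.
-- The threshold `r` is for squared lengths.
record Long-pair (r : ℚ) (u v w : Vector) : Set where
  field
    u-long  : r < ∥ u ∥²
    vw-long : r < ∥ v ⊖ w ∥²
    v-short : ∥ v ∥² ≤ r
    w-short : ∥ w ∥² ≤ r
    uv-short : ∥ u ⊖ v ∥² ≤ r
    uw-short : ∥ u ⊖ w ∥² ≤ r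

module _ {r u v w} (long : Long-pair r u v w) where
  open Long-pair long

  exchange : Long-pair r u w v
  exchange = record
    { u-long = u-long ; vw-long = subst (r <_) (∥⊖∥²-comm v w) vw-long
    ; v-short = w-short ; w-short = v-short ; uv-short = uw-short ; uw-short = uv-short }

  -- Swapping coordinates is a reflection: it keeps norms and negates `∧`, so results for
  -- nonnegative signs carry over to nonpositive ones.
  reflect : Long-pair r (swap u) (swap v) (swap w)
  reflect = record
    { u-long = subst (r <_) (sym (∥swap∥² u)) u-long
    ; vw-long = subst (r <_) (sym (∥swap∥² (v ⊖ w))) vw-long
    ; v-short = subst (_≤ r) (sym (∥swap∥² v)) v-short
    ; w-short = subst (_≤ r) (sym (∥swap∥² w)) w-short
    ; uv-short = subst (_≤ r) (sym (∥swap∥² (u ⊖ v))) uv-short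
    ; uw-short = subst (_≤ r) (sym (∥swap∥² (u ⊖ w))) uw-short }

  private
    _≺_ : ∀ {s l} → s ≤ r → r < l → 0ℚ < l - s
    s≤r ≺ r<l = 0<q-p (ℚ.≤-<-trans s≤r r<l)

    0<l+l-[s+s]+t : ∀ {s s′ l t} → s ≤ r → s′ ≤ r → r < l → 0ℚ ≤ t → 0ℚ < (l + l - (s + s′)) + t
    0<l+l-[s+s]+t s≤r s′≤r r<l 0≤t = ℚ.+-mono-<-≤
      (0<q-p (ℚ.+-mono-< (ℚ.≤-<-trans s≤r r<l) (ℚ.≤-<-trans s′≤r r<l))) 0≤t

  -- u and v ⊖ w are not parallel: twice their inner product is smaller in
  -- absolute value than both 2∥u∥² and 2∥v ⊖ w∥².
  not-parallel : u ∧ v ≢ u ∧ w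
  not-parallel uv≡uw = ℚ.<-irrefl (sym zero-sum) (ℚ.+-mono-<
    (*-pos (0<l+l-[s+s]+t w-short uv-short u-long 0≤t) (0<l+l-[s+s]+t v-short uw-short vw-long 0≤s))
    (*-pos (0<l+l-[s+s]+t v-short uw-short u-long 0≤s) (0<l+l-[s+s]+t w-short uv-short vw-long 0≤t)))
    where
    0≤s : 0ℚ ≤ ∥ w ∥² + ∥ u ⊖ v ∥²
    0≤s = ℚ.+-mono-≤ (0≤∥∥² w) (0≤∥∥² (u ⊖ v))
    0≤t : 0ℚ ≤ ∥ v ∥² + ∥ u ⊖ w ∥²
    0≤t = ℚ.+-mono-≤ (0≤∥∥² v) (0≤∥∥² (u ⊖ w))
    8*0≡0 : ∀ {p q} → p ≡ q → (1ℚ + 1ℚ) * (1ℚ + 1ℚ) * (1ℚ + 1ℚ) * ((q - p) * (q - p)) ≡ 0ℚ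
    8*0≡0 {p} refl rewrite ℚ.+-inverseʳ p = refl
    zero-sum = trans (lagrange u v w) (8*0≡0 uv≡uw)

  -- Up to degeneracy, these signs leave two shapes, told apart by the orientation of the triangle
  -- u, v, w: either `v` lies in the triangle 0, u, w, or 0, u, v, w is a convex quadrilateral whose
  -- diagonals are short. In each, a separating identity writes 0 as a sum of nonnegative terms, one
  -- of them positive.
  not-all-nonneg : 0ℚ ≤ u ∧ v → 0ℚ ≤ u ∧ w → 0ℚ ≤ v ∧ w → ⊥
  not-all-nonneg 0≤X 0≤Y 0≤Z with u ∧ w ℚ.≤? u ∧ v + v ∧ w
  ... | no Y≰X+Z = ℚ.<-irrefl (sym (separating-vertex u v w)) (ℚ.+-mono-≤-<
    (ℚ.+-mono-≤
      (0≤*0≤ 0≤X (ℚ.+-mono-≤ (0≤∥∥² (v ⊖ w)) (0≤∥∥² (v ⊖ w))))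
      (0≤*0≤ 0≤Z (ℚ.+-mono-≤ (0≤∥∥² (u ⊖ v)) (ℚ.<⇒≤ (uw-short ≺ vw-long)))))
    (*-pos (0<q-p (ℚ.≰⇒> Y≰X+Z)) (ℚ.+-mono-≤-< (0≤∥∥² v) (w-short ≺ vw-long))))
  ... | yes Y≤X+Z = sum-pos (ℚ.<-cmp (u ∧ v) (u ∧ w))
    where
    c₀ : 0ℚ < ∥ u ∥² - ∥ v ∥² + ∥ w ∥²
    c₀ = ℚ.+-mono-<-≤ (v-short ≺ u-long) (0≤∥∥² w)
    cᵥ : 0ℚ < ∥ u ⊖ v ∥² + (∥ v ⊖ w ∥² - ∥ v ∥²)
    cᵥ = ℚ.+-mono-≤-< (0≤∥∥² (u ⊖ v)) (v-short ≺ vw-long)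
    c_w : 0ℚ < ∥ v ⊖ w ∥² - ∥ u ⊖ w ∥² + ∥ w ∥²
    c_w = ℚ.+-mono-<-≤ (uw-short ≺ vw-long) (0≤∥∥² w)
    cᵤ : 0ℚ < ∥ u ⊖ v ∥² + (∥ u ∥² - ∥ u ⊖ w ∥²)
    cᵤ = ℚ.+-mono-≤-< (0≤∥∥² (u ⊖ v)) (uw-short ≺ u-long)
    t₀ = 0≤*0≤ (0≤q-p Y≤X+Z) (ℚ.<⇒≤ c₀)
    tᵤ = 0≤*0≤ 0≤Z (ℚ.<⇒≤ cᵤ)
    -- All four coefficients are fine; what remains is a positive weight. The larger of `u ∧ v` and
    -- `u ∧ w` is one, unless they are equal, which `not-parallel` excludes.
    sum-pos : _ → ⊥
    sum-pos (tri≈ _ X≡Y _) = not-parallel X≡Y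
    sum-pos (tri< X<Y _ _) = ℚ.<-irrefl (sym (separating-line u v w)) (ℚ.+-mono-<-≤
      (ℚ.+-mono-<-≤ (ℚ.+-mono-≤-< t₀ (*-pos (ℚ.≤-<-trans 0≤X X<Y) cᵥ)) (0≤*0≤ 0≤X (ℚ.<⇒≤ c_w))) tᵤ)
    sum-pos (tri> _ _ Y<X) = ℚ.<-irrefl (sym (separating-line u v w)) (ℚ.+-mono-<-≤
      (ℚ.+-mono-≤-< (ℚ.+-mono-≤ t₀ (0≤*0≤ 0≤Y (ℚ.<⇒≤ cᵥ))) (*-pos (ℚ.≤-<-trans 0≤Y Y<X) c_w)) tᵤ)

-- Exchanging `v` and `w` negates `v ∧ w` and permutes the two hypotheses, so `v ∧ w` may be taken
-- nonnegative.
not-same-side : ∀ {r u v w} → Long-pair r u v w → 0ℚ ≤ u ∧ v → 0ℚ ≤ u ∧ w → ⊥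
not-same-side {u = u} {v} {w} long 0≤X 0≤Y with ℚ.≤-total 0ℚ (v ∧ w)
... | inj₁ 0≤Z = not-all-nonneg long 0≤X 0≤Y 0≤Z
... | inj₂ Z≤0 = not-all-nonneg (exchange long) 0≤Y 0≤X
  (subst (0ℚ ≤_) (sym (∧-antisym w v)) (ℚ.neg-antimono-≤ Z≤0))

not-same-side′ : ∀ {r u v w} → Long-pair r u v w → u ∧ v ≤ 0ℚ → u ∧ w ≤ 0ℚ → ⊥
not-same-side′ {u = u} {v} {w} long X≤0 Y≤0 = not-same-side (reflect long)
  (subst (0ℚ ≤_) (sym (∧-swap u v)) (ℚ.neg-antimono-≤ X≤0))
  (subst (0ℚ ≤_) (sym (∧-swap u w)) (ℚ.neg-antimono-≤ Y≤0))

-- The same-side cases were excluded with weak inequalities, so neither sign can be zero.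
opposite-sides : ∀ {r u v w} → Long-pair r u v w → Opposite (u ∧ v) (u ∧ w)
opposite-sides {u = u} {v} {w} long with 0ℚ ℚ.≤? u ∧ v | 0ℚ ℚ.≤? u ∧ w
... | yes 0≤X | yes 0≤Y = ⊥-elim (not-same-side long 0≤X 0≤Y)
... | yes 0≤X | no 0≰Y = inj₂ (ℚ.≰⇒> (λ X≤0 → not-same-side′ long X≤0 (ℚ.<⇒≤ (ℚ.≰⇒> 0≰Y))) , ℚ.≰⇒> 0≰Y)
... | no 0≰X | yes 0≤Y = inj₁ (ℚ.≰⇒> 0≰X , ℚ.≰⇒> (not-same-side′ long (ℚ.<⇒≤ (ℚ.≰⇒> 0≰X))))
... | no 0≰X | no 0≰Y = ⊥-elim (not-same-side′ long (ℚ.<⇒≤ (ℚ.≰⇒> 0≰X)) (ℚ.<⇒≤ (ℚ.≰⇒> 0≰Y)))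

-- Signs of cross products of edges in crossings.

⊖-cancel : ∀ a b c → (b ⊖ a) ⊖ (c ⊖ a) ≡ b ⊖ c
⊖-cancel (a₁ , a₂) (b₁ , b₂) (c₁ , c₂) = cong₂ _,_ (cancel a₁ b₁ c₁) (cancel a₂ b₂ c₂)
  where
  cancel : ∀ a b c → b - a - (c - a) ≡ b - c
  cancel = solve 3 (λ a b c → b :- a :- (c :- a) := b :- c) refl

∧-⊖ : ∀ u a c d → u ∧ (d ⊖ c) ≡ u ∧ (d ⊖ a) - u ∧ (c ⊖ a)
∧-⊖ (u₁ , u₂) (a₁ , a₂) (c₁ , c₂) (d₁ , d₂) = solve 8 (λ u₁ u₂ a₁ a₂ c₁ c₂ d₁ d₂ →
  let u = u₁ , u₂ ; a = a₁ , a₂ ; c = c₁ , c₂ ; d = d₁ , d₂ in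
  u ∧ₑ (d ⊖ₑ c) := u ∧ₑ (d ⊖ₑ a) :- u ∧ₑ (c ⊖ₑ a)) refl u₁ u₂ a₁ a₂ c₁ c₂ d₁ d₂

Far Near : ℚ → Vector → Vector → Set
Far  r a b = r < ∥ a ⊖ b ∥²
Near r a b = ∥ a ⊖ b ∥² ≤ r

Near-sym : ∀ {r a b} → Near r a b → Near r b a
Near-sym {r} {a} {b} = subst (_≤ r) (∥⊖∥²-comm a b)

record Crossing (r : ℚ) (a b c d : Vector) : Set where
  field
    ab : Far r a b
    cd : Far r c d
    ac : Near r a c
    ad : Near r a d
    bc : Near r b c
    bd : Near r b d

Crossing-sym : ∀ {r a b c d} → Crossing r a b c d → Crossing r c d a b
Crossing-sym {a = a} {b} {c} {d} x = record
  { ab = cd ; cd = ab ; ac = Near-sym {a = a} {c} ac ; ad = Near-sym {a = b} {c} bc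
  ; bc = Near-sym {a = a} {d} ad ; bd = Near-sym {a = b} {d} bd }
  where open Crossing x

endpoints-opposite : ∀ {r a b c d} → Crossing r a b c d →
                     Opposite ((b ⊖ a) ∧ (c ⊖ a)) ((b ⊖ a) ∧ (d ⊖ a))
endpoints-opposite {r} {a} {b} {c} {d} x = opposite-sides {u = b ⊖ a} {c ⊖ a} {d ⊖ a} (record
  { u-long   = subst (r <_) (∥⊖∥²-comm a b) ab
  ; vw-long  = subst (r <_) (cong ∥_∥² (sym (⊖-cancel a c d))) cd
  ; v-short  = Near-sym {a = a} {c} ac
  ; w-short  = Near-sym {a = a} {d} ad
  ; uv-short = subst (_≤ r) (cong ∥_∥² (sym (⊖-cancel a b c))) bc
  ; uw-short = subst (_≤ r) (cong ∥_∥² (sym (⊖-cancel a b d))) bd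
  })
  where open Crossing x

positive? : ℚ → Bool
positive? q = does (0ℚ ℚ.<? q)

0<⇒positive : ∀ {q} → 0ℚ < q → positive? q ≡ true
0<⇒positive {q} 0<q = dec-true (0ℚ ℚ.<? q) 0<q

<0⇒nonpositive : ∀ {q} → q < 0ℚ → positive? q ≡ false
<0⇒nonpositive {q} q<0 = dec-false (0ℚ ℚ.<? q) (ℚ.<-asym q<0)

Opposite-positive? : ∀ {p q} → Opposite p q → positive? q ≡ not (positive? p)
Opposite-positive? (inj₁ (p<0 , 0<q)) =
  trans (0<⇒positive 0<q) (cong not (sym (<0⇒nonpositive p<0)))
Opposite-positive? (inj₂ (0<p , q<0)) =
  trans (<0⇒nonpositive q<0) (cong not (sym (0<⇒positive 0<p)))

-- The hypothesis supplies that `p` is nonzero; at 0 negation would leave `positive?` unchanged.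
Opposite-negate : ∀ {p q} → Opposite p q → positive? (- p) ≡ not (positive? p)
Opposite-negate (inj₁ (p<0 , _)) =
  trans (0<⇒positive (ℚ.neg-antimono-< p<0)) (cong not (sym (<0⇒nonpositive p<0)))
Opposite-negate (inj₂ (0<p , _)) =
  trans (<0⇒nonpositive (ℚ.neg-antimono-< 0<p)) (cong not (sym (0<⇒positive 0<p)))

Opposite-neg : ∀ {p q} → Opposite p q → Opposite (- p) (- q)
Opposite-neg (inj₁ (p<0 , 0<q)) = inj₂ (ℚ.neg-antimono-< p<0 , ℚ.neg-antimono-< 0<q)
Opposite-neg (inj₂ (0<p , q<0)) = inj₁ (ℚ.neg-antimono-< 0<p , ℚ.neg-antimono-< q<0)

-- The signs of `p`, `q`, `s` alternate, so each difference takes the sign of its minuend.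
Opposite-differences : ∀ {p q s} → Opposite p q → Opposite q s → Opposite (q - p) (s - q)
Opposite-differences {p} {q} {s} = by
  where
  neg : ∀ {a b} → a < 0ℚ → 0ℚ < b → a - b < 0ℚ
  neg a<0 0<b = ℚ.+-mono-< a<0 (ℚ.neg-antimono-< 0<b)
  by : Opposite p q → Opposite q s → Opposite (q - p) (s - q)
  by (inj₁ (p<0 , 0<q)) (inj₂ (_ , s<0)) = inj₂ (ℚ.+-mono-< 0<q (ℚ.neg-antimono-< p<0) , neg s<0 0<q)
  by (inj₂ (0<p , q<0)) (inj₁ (_ , 0<s)) = inj₁ (neg q<0 0<p , ℚ.+-mono-< 0<s (ℚ.neg-antimono-< q<0))
  by (inj₁ (_ , 0<q)) (inj₁ (q<0 , _)) = ⊥-elim (ℚ.<-asym 0<q q<0)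
  by (inj₂ (_ , q<0)) (inj₂ (0<q , _)) = ⊥-elim (ℚ.<-asym 0<q q<0)

-- The path c, d, e crosses the line ab and then crosses back, so its two edges pass that line in
-- opposite directions.
turn : ∀ {r a b c d e} → Crossing r a b c d → Crossing r a b d e →
       Opposite ((b ⊖ a) ∧ (d ⊖ c)) ((b ⊖ a) ∧ (e ⊖ d))
turn {a = a} {b} {c} {d} {e} x y = subst₂ Opposite
  (sym (∧-⊖ (b ⊖ a) a c d)) (sym (∧-⊖ (b ⊖ a) a d e))
  (Opposite-differences (endpoints-opposite x) (endpoints-opposite y))

turn′ : ∀ {r a b c d e} → Crossing r c d a b → Crossing r d e a b →
        Opposite ((d ⊖ c) ∧ (b ⊖ a)) ((e ⊖ d) ∧ (b ⊖ a))
turn′ {a = a} {b} {c} {d} {e} x y = subst₂ Opposite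
  (sym (∧-antisym (d ⊖ c) (b ⊖ a))) (sym (∧-antisym (e ⊖ d) (b ⊖ a)))
  (Opposite-neg (turn (Crossing-sym x) (Crossing-sym y)))

-- Even antiholes are impossible: the walk of edge pairs.

record Antihole (n : ℕ) (r : ℚ) (p : ℕ → Vector) : Set where
  field
    periodic : ∀ i → p (i ℕ.+ n) ≡ p i
    far      : ∀ i → Far r (p i) (p (suc i))
    near     : ∀ i j → 2 ℕ.+ i ℕ.≤ j → 2 ℕ.+ j ℕ.≤ n ℕ.+ i → Near r (p i) (p j)

module _ {n r p} (A : Antihole n r p) where
  open Antihole A

  direction : ℕ → ℕ → Bool
  direction i j = positive? ((p (suc i) ⊖ p i) ∧ (p (suc j) ⊖ p j))

  -- The tightest pairs are i + 1, j and j + 1, i + n; the two bounds keep each of them at distance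
  -- at least 2.
  crossing : ∀ i j → 3 ℕ.+ i ℕ.≤ j → 3 ℕ.+ j ℕ.≤ n ℕ.+ i →
             Crossing r (p i) (p (suc i)) (p j) (p (suc j))
  crossing i j i≪j j≪i = record
    { ab = far i ; cd = far j
    ; ac = near i j (ℕ.<⇒≤ i≪j) (ℕ.<⇒≤ j≪i)
    ; ad = near i (suc j) (ℕ.m≤n⇒m≤1+n (ℕ.<⇒≤ i≪j)) j≪i
    ; bc = near (suc i) j i≪j (subst (2 ℕ.+ j ℕ.≤_) (sym (ℕ.+-suc n i)) (ℕ.m≤n⇒m≤1+n (ℕ.<⇒≤ j≪i)))
    ; bd = near (suc i) (suc j) (ℕ.m≤n⇒m≤1+n i≪j) (subst (3 ℕ.+ j ℕ.≤_) (sym (ℕ.+-suc n i)) (ℕ.m≤n⇒m≤1+n j≪i))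
    }

  direction-sucʳ : ∀ i j → 3 ℕ.+ i ℕ.≤ j → 4 ℕ.+ j ℕ.≤ n ℕ.+ i →
                   direction i (suc j) ≡ not (direction i j)
  direction-sucʳ i j i≪j j≪i = Opposite-positive? (turn
    (crossing i j i≪j (ℕ.<⇒≤ j≪i)) (crossing i (suc j) (ℕ.m≤n⇒m≤1+n i≪j) j≪i))

  direction-sucˡ : ∀ i j → 4 ℕ.+ i ℕ.≤ j → 3 ℕ.+ j ℕ.≤ n ℕ.+ i →
                   direction (suc i) j ≡ not (direction i j)
  direction-sucˡ i j i≪j j≪i = Opposite-positive? (turn′
    (crossing i j (ℕ.<⇒≤ i≪j) j≪i)
    (crossing (suc i) j i≪j (subst (3 ℕ.+ j ℕ.≤_) (sym (ℕ.+-suc n i)) (ℕ.m≤n⇒m≤1+n j≪i))))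

  -- Antisymmetry of `∧` flips the Boolean only for a nonzero cross product, which `turn` provides.
  direction-antisym : ∀ i j → 3 ℕ.+ i ℕ.≤ j → 4 ℕ.+ j ℕ.≤ n ℕ.+ i → direction j i ≡ not (direction i j)
  direction-antisym i j i≪j j≪i = trans
    (cong positive? (∧-antisym (p (suc j) ⊖ p j) (p (suc i) ⊖ p i)))
    (Opposite-negate (turn
      (crossing i j i≪j (ℕ.<⇒≤ j≪i)) (crossing i (suc j) (ℕ.m≤n⇒m≤1+n i≪j) j≪i)))

  direction-periodic : ∀ i → direction i n ≡ direction i 0
  direction-periodic i = cong₂ (λ a b → positive? ((p (suc i) ⊖ p i) ∧ (b ⊖ a))) (periodic 0) (periodic 1)

-- The second edge makes 2t moves, then the first and second alternate for six more. The flips are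
-- grouped in cancelling pairs, which is where evenness enters.
no-even-antihole : ∀ {s r p} → let t = suc s in ¬ Antihole (6 ℕ.+ (t ℕ.+ t)) r p
no-even-antihole {s} {r} {p} A = not-¬ refl (begin
  direction A 0 3          ≡⟨ along t ℕ.≤-refl ⟨
  direction A 0 J          ≡⟨ not-not (direction-sucˡ A 0 J 4≤J (ℕ.m≤m+n n 0))
                                      (direction-sucʳ A 1 J 4≤J (k+n≤n+k 1)) ⟨
  direction A 1 (1 ℕ.+ J)  ≡⟨ not-not (direction-sucˡ A 1 (1 ℕ.+ J) (ℕ.s≤s 4≤J) (k+n≤n+k 1))
                                      (direction-sucʳ A 2 (1 ℕ.+ J) (ℕ.s≤s 4≤J) (k+n≤n+k 2)) ⟨
  direction A 2 (2 ℕ.+ J)  ≡⟨ not-not (direction-sucˡ A 2 (2 ℕ.+ J) (ℕ.s≤s (ℕ.s≤s 4≤J)) (k+n≤n+k 2))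
                                      (direction-sucʳ A 3 (2 ℕ.+ J) (ℕ.s≤s (ℕ.s≤s 4≤J)) (k+n≤n+k 3)) ⟨
  direction A 3 n          ≡⟨ direction-periodic A 3 ⟩
  direction A 3 0          ≡⟨ direction-antisym A 0 3 ℕ.≤-refl 7≤n ⟩
  not (direction A 0 3)    ∎)
  where
  open ≡-Reasoning
  t J n : ℕ
  t = suc s
  -- `J` is n - 3, the farthest position of the second edge that still crosses edge 0. In the
  -- alternating stage the gap is n - 4 or n - 3.
  J = 3 ℕ.+ (t ℕ.+ t)
  n = 3 ℕ.+ J
  4≤J : 4 ℕ.≤ J
  4≤J = ℕ.+-monoʳ-≤ 3 (ℕ.s≤s ℕ.z≤n)
  7≤n : 7 ℕ.≤ n ℕ.+ 0
  7≤n = ℕ.+-monoʳ-≤ 6 (ℕ.s≤s ℕ.z≤n)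
  k+n≤n+k : ∀ k → k ℕ.+ n ℕ.≤ n ℕ.+ k
  k+n≤n+k k = ℕ.≤-reflexive (ℕ.+-comm k n)
  not-not : ∀ {a b c} → b ≡ not a → c ≡ not b → c ≡ a
  not-not refl refl = not-involutive _
  along : ∀ i → i ℕ.≤ t → direction A 0 (3 ℕ.+ (i ℕ.+ i)) ≡ direction A 0 3
  along zero    _   = refl
  along (suc i) i<t = trans (cong (λ j → direction A 0 (4 ℕ.+ j)) (ℕ.+-suc i i)) (trans
    (not-not (direction-sucʳ A 0 j 3≤j (ℕ.≤-trans (ℕ.n≤1+n _) 8+2i≤n))
             (direction-sucʳ A 0 (suc j) (ℕ.m≤n⇒m≤1+n 3≤j) 8+2i≤n))
    (along i (ℕ.<⇒≤ i<t)))
    where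
    j : ℕ
    j = 3 ℕ.+ (i ℕ.+ i)
    3≤j : 3 ℕ.≤ j
    3≤j = ℕ.m≤m+n 3 (i ℕ.+ i)
    8+2i≤n : 8 ℕ.+ (i ℕ.+ i) ℕ.≤ n ℕ.+ 0
    8+2i≤n = ℕ.≤-trans
      (ℕ.+-monoʳ-≤ 6 (ℕ.≤-trans (ℕ.s≤s (ℕ.≤-reflexive (sym (ℕ.+-suc i i)))) (ℕ.+-mono-≤ i<t i<t)))
      (ℕ.m≤m+n n 0)

-- From real distances to squared distances of rational approximations.

square-mono-< : ∀ {p q} → 0ℚ ≤ p → p < q → p * p < q * q
square-mono-< {p} {q} 0≤p p<q = ℚ.≤-<-trans
  (ℚ.*-monoˡ-≤-nonNeg p {{ℚ.nonNegative 0≤p}} (ℚ.<⇒≤ p<q))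
  (ℚ.*-monoˡ-<-pos q {{ℚ.positive (ℚ.≤-<-trans 0≤p p<q)}} p<q)

square-cancel-≤ : ∀ {p q} → 0ℚ ≤ q → p * p ≤ q * q → p ≤ q
square-cancel-≤ {p} {q} 0≤q p²≤q² = ℚ.≮⇒≥ λ q<p →
  ℚ.<-irrefl refl (ℚ.<-≤-trans (square-mono-< 0≤q q<p) p²≤q²)

0<1 : 0ℚ < 1ℚ
0<1 = ℚ.positive⁻¹ 1ℚ

-- The lower bisection end satisfies l² ≤ max(x, 0) at every stage, and 1 + ε ≤ (1 + ε)², so the
-- index for `x` serves for its root.
≤1⇒√≤1 : ∀ x → x ≤ℝ 1ℝ → √ x ≤ℝ 1ℝ
≤1⇒√≤1 x x≤1 ε 0<ε = let N , bound = x≤1 ε 0<ε in N , λ n N≤n →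
  square-cancel-≤ (ℚ.<⇒≤ 0<1+ε) (begin
    √-seq (seq x) n * √-seq (seq x) n ≤⟨ l²≤q (bisect-bracket (ℚ.p≤q⊔p (seq x n) 0ℚ) n) ⟩
    seq x n ⊔ 0ℚ                      ≤⟨ ℚ.⊔-lub (bound n N≤n) (ℚ.<⇒≤ 0<1+ε) ⟩
    1ℚ + ε                            ≡⟨ ℚ.*-identityˡ (1ℚ + ε) ⟨
    1ℚ * (1ℚ + ε)                     ≤⟨ ℚ.*-monoʳ-≤-nonNeg (1ℚ + ε) {{ℚ.nonNegative (ℚ.<⇒≤ 0<1+ε)}} 1≤1+ε ⟩
    (1ℚ + ε) * (1ℚ + ε)               ∎)
  where
  open ℚ.≤-Reasoning
  0<1+ε : 0ℚ < 1ℚ + ε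
  0<1+ε = ℚ.+-mono-< 0<1 0<ε
  1≤1+ε : 1ℚ ≤ 1ℚ + ε
  1≤1+ε = ℚ.+-monoʳ-≤ 1ℚ (ℚ.<⇒≤ 0<ε)

-- η = min(1, ε) / 8 satisfies (1 + η + η)² ≤ 1 + ε.
square-near-1 : ∀ {ε} → 0ℚ < ε → ∃[ η ] 0ℚ < η × (1ℚ + (η + η)) * (1ℚ + (η + η)) ≤ 1ℚ + ε
square-near-1 {ε} 0<ε = η , *-pos 0<⅛ (0<⊓ 0<ε) , (begin
  (1ℚ + (η + η)) * (1ℚ + (η + η))
    ≡⟨ solve 1 (λ m → let h = con ⅛ :* m in
         (con 1ℚ :+ (h :+ h)) :* (con 1ℚ :+ (h :+ h)) := con 1ℚ :+ (con ½ :* m :+ con ½ :* (con ⅛ :* (m :* m))))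
       refl m ⟩
  1ℚ + (½ * m + ½ * (⅛ * (m * m)))
    ≤⟨ ℚ.+-monoʳ-≤ 1ℚ (ℚ.+-monoʳ-≤ (½ * m) (ℚ.*-monoˡ-≤-nonNeg ½ ⅛m²≤m)) ⟩
  1ℚ + (½ * m + ½ * m)
    ≡⟨ cong (1ℚ +_) (halves m) ⟩
  1ℚ + m
    ≤⟨ ℚ.+-monoʳ-≤ 1ℚ (ℚ.p⊓q≤q 1ℚ ε) ⟩
  1ℚ + ε ∎)
  where
  open ℚ.≤-Reasoning
  ⅛ m η : ℚ
  ⅛ = ½ * (½ * ½)
  m = 1ℚ ℚ.⊓ ε
  η = ⅛ * m
  0<⅛ : 0ℚ < ⅛
  0<⅛ = ℚ.positive⁻¹ ⅛
  0<⊓ : ∀ {q} → 0ℚ < q → 0ℚ < 1ℚ ℚ.⊓ q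
  0<⊓ {q} 0<q with ℚ.⊓-sel 1ℚ q
  ... | inj₁ ≡1 = subst (0ℚ <_) (sym ≡1) 0<1
  ... | inj₂ ≡q = subst (0ℚ <_) (sym ≡q) 0<q
  0≤m : 0ℚ ≤ m
  0≤m = ℚ.<⇒≤ (0<⊓ 0<ε)
  ⅛m²≤m : ⅛ * (m * m) ≤ m
  ⅛m²≤m = begin
    ⅛ * (m * m)  ≤⟨ ℚ.*-monoʳ-≤-nonNeg (m * m) {{ℚ.nonNegative (0≤p² m)}} (ℚ.≤ᵇ⇒≤ {⅛} {1ℚ} _) ⟩
    1ℚ * (m * m) ≡⟨ ℚ.*-identityˡ (m * m) ⟩
    m * m        ≤⟨ ℚ.*-monoˡ-≤-nonNeg m {{ℚ.nonNegative 0≤m}} (ℚ.p⊓q≤p 1ℚ ε) ⟩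
    m * 1ℚ       ≡⟨ ℚ.*-identityʳ m ⟩
    m            ∎

-- The lower end gives no upper bound on `x`, so the upper end is used. It is at most 1 + 2η once
-- the interval has width at most η; that width depends on `seq x n`, hence the bound `B`.
√≤1⇒≤1 : ∀ x → √ x ≤ℝ 1ℝ → x ≤ℝ 1ℝ
√≤1⇒≤1 x √x≤1 ε 0<ε =
  let η , 0<η , square≤ = square-near-1 0<ε
      B , 0<B , K , bound = bounded {seq x} (cauchy x)
      L , width = small (ℚ.+-mono-< 0<1 0<B) 0<η
      M , √bound = √x≤1 η 0<η
  in K ℕ.⊔ (L ℕ.⊔ M) , λ n N≤n →
    let K≤n = ℕ.m⊔n≤o⇒m≤o K (L ℕ.⊔ M) N≤n
        L⊔M≤n = ℕ.m⊔n≤o⇒n≤o K (L ℕ.⊔ M) N≤n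
        bracket = bisect-bracket (ℚ.p≤q⊔p (seq x n) 0ℚ) n
    in ℚ.≤-trans (ℚ.p≤p⊔q (seq x n) 0ℚ) (ℚ.≤-trans (ℚ.<⇒≤ (q<h² bracket)) (ℚ.≤-trans
         (*-mono-≤-nonNeg (ℚ.≤-trans (0≤l bracket) (l≤h bracket))
           (upper≤ n η B (√bound n (ℕ.m⊔n≤o⇒n≤o L M L⊔M≤n)) (⊔≤ (bound n K≤n) (ℚ.<⇒≤ 0<B))
             (ℚ.<⇒≤ (width n (ℕ.m⊔n≤o⇒m≤o L M L⊔M≤n)))))
         square≤))
  where
  open ℚ.≤-Reasoning
  ⊔≤ : ∀ {p B} → ℚ.∣ p ∣ < B → 0ℚ ≤ B → p ⊔ 0ℚ ≤ B
  ⊔≤ {p} {B} ∣p∣<B 0≤B = ℚ.⊔-lub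
    (subst (p ≤_) (ℚ.+-identityˡ B) (diff⇒≤ {p} {0ℚ} (<-step (cong ℚ.∣_∣ (ℚ.+-identityʳ p)) ∣p∣<B))) 0≤B
  upper≤ : ∀ n η B → √-seq (seq x) n ≤ 1ℚ + η → seq x n ⊔ 0ℚ ≤ B → (1ℚ + B) * ½^ n ≤ η →
           proj₂ (bisect (seq x n ⊔ 0ℚ) n) ≤ 1ℚ + (η + η)
  upper≤ n η B l≤ q≤B w≤η = let q = seq x n ⊔ 0ℚ ; l , h = bisect q n in begin
    h                      ≡⟨ solve 2 (λ l h → h := l :+ (h :- l)) refl l h ⟩
    l + (h - l)            ≡⟨ cong (l +_) (bisect-width q n) ⟩
    l + (1ℚ + q) * ½^ n    ≤⟨ ℚ.+-mono-≤ l≤ (ℚ.*-monoʳ-≤-nonNeg (½^ n) {{ℚ.nonNegative (ℚ.<⇒≤ (½^-pos n))}}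
                                (ℚ.+-monoʳ-≤ 1ℚ q≤B)) ⟩
    1ℚ + η + (1ℚ + B) * ½^ n ≤⟨ ℚ.+-monoʳ-≤ (1ℚ + η) w≤η ⟩
    1ℚ + η + η             ≡⟨ ℚ.+-assoc 1ℚ η η ⟩
    1ℚ + (η + η)           ∎

-- A late term above 1 + ε would keep all later terms above 1 + ε/2, making its index a witness. One
-- number is both index and margin exponent, so the condition persists when it grows.
≰1⇒¬¬1< : ∀ x → ¬ x ≤ℝ 1ℝ → ¬ ¬ (∃[ N ] ∀ n → N ℕ.≤ n → 1ℚ + ½^ N < seq x n)
≰1⇒¬¬1< x x≰1 none = x≰1 λ ε 0<ε →
  let M , hM = small 0<1 (half-pos 0<ε)
      N , hN = cauchy x (½ * ε) (half-pos 0<ε)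
  in M ℕ.⊔ N , λ n M⊔N≤n →
    let M≤n = ℕ.m⊔n≤o⇒m≤o M N M⊔N≤n
        N≤n = ℕ.m⊔n≤o⇒n≤o M N M⊔N≤n
    in ℚ.≮⇒≥ λ 1+ε<xₙ → none (n , λ m n≤m →
      above {seq x n} {seq x m} {ε} {½^ n} 1+ε<xₙ (hN n m N≤n (ℕ.≤-trans N≤n n≤m)) (hM n M≤n))
  where
  open ℚ.≤-Reasoning
  above : ∀ {p q ε h} → 1ℚ + ε < p → ℚ.∣ p - q ∣ < ½ * ε → 1ℚ * h < ½ * ε → 1ℚ + h < q
  above {p} {q} {ε} {h} 1+ε<p p≈q h<½ε = begin-strict
    1ℚ + h                      ≡⟨ cong (1ℚ +_) (sym (ℚ.*-identityˡ h)) ⟩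
    1ℚ + 1ℚ * h                 <⟨ ℚ.+-monoʳ-< 1ℚ h<½ε ⟩
    1ℚ + ½ * ε                  ≡⟨ solve 1 (λ e → con 1ℚ :+ con ½ :* e := con 1ℚ :+ e :- con ½ :* e) refl ε ⟩
    1ℚ + ε - ½ * ε              <⟨ ℚ.+-monoˡ-< (- (½ * ε)) 1+ε<p ⟩
    p - ½ * ε                   ≤⟨ ℚ.+-monoˡ-≤ (- (½ * ε)) (diff⇒≤ {p} {q} p≈q) ⟩
    q + ½ * ε - ½ * ε           ≡⟨ solve 2 (λ q e → q :+ e :- e := q) refl q (½ * ε) ⟩
    q                           ∎

-- Double negation commutes with finite conjunction, and by monotonicity the maximum of the
-- witnesses serves all members.
¬¬∃-uniform : ∀ m (P : Fin m → ℕ → Set) → (∀ i {a b} → a ℕ.≤ b → P i a → P i b) →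
              (∀ i → ¬ ¬ ∃ (P i)) → ¬ ¬ (∃[ N ] ∀ i → P i N)
¬¬∃-uniform zero    P mono each none = none (0 , λ ())
¬¬∃-uniform (suc m) P mono each none =
  each zero λ (a , p₀) →
  ¬¬∃-uniform m (λ i → P (suc i)) (λ i → mono (suc i)) (λ i → each (suc i)) λ (b , p₊) →
  none (a ℕ.⊔ b , λ where
    zero    → mono zero (ℕ.m≤m⊔n a b) p₀
    (suc i) → mono (suc i) (ℕ.m≤n⊔m a b) (p₊ i))

¬¬∃-uniform₂ : ∀ m n (P : Fin m → Fin n → ℕ → Set) → (∀ i j {a b} → a ℕ.≤ b → P i j a → P i j b) →
               (∀ i j → ¬ ¬ ∃ (P i j)) → ¬ ¬ (∃[ N ] ∀ i j → P i j N)
¬¬∃-uniform₂ m n P mono each = ¬¬∃-uniform m (λ i N → ∀ j → P i j N)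
  (λ i a≤b p j → mono i j a≤b (p j))
  (λ i → ¬¬∃-uniform n (P i) (mono i) (each i))

approx : Point → ℕ → Vector
approx (x , y) n = seq x n , seq y n

sqDist : Point → Point → ℝ
sqDist (x , y) (x′ , y′) = (x -ℝ x′) *ℝ (x -ℝ x′) +ℝ (y -ℝ y′) *ℝ (y -ℝ y′)

module _ {n} (G : Graph n) where
  open Graph G

  -- The points are approximations to the given real ones; raising the
  -- threshold from 1 to r leaves room for the error.
  rational-representation : IsUDG (complement G) → ¬ ¬ (∃[ r ] ∃[ q ]
    (∀ u v → u ~ v → Far r (q u) (q v)) × (∀ u v → u ≢ v → ¬ u ~ v → Near r (q u) (q v)))
  rational-representation (f , f-spec) none =
    -- The far pairs come first: they fix the margin `½^ N` within which the near pairs must then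
    -- fall.
    ¬¬∃-uniform₂ n n IsFar isFar-mono isFar λ (N , far) →
    ¬¬∃-uniform₂ n n (IsNear N) (isNear-mono N) (λ u v none → none (isNear N u v)) λ (M , near) →
    none (1ℚ + ½^ N , (λ u → approx (f u) (N ℕ.⊔ M)) ,
      (λ u v u~v → far u v u~v (N ℕ.⊔ M) (ℕ.m≤m⊔n N M)) ,
      (λ u v u≢v u≁v → near u v u≢v u≁v (N ℕ.⊔ M) (ℕ.m≤n⊔m N M)))
    where
    IsFar : Fin n → Fin n → ℕ → Set
    IsFar u v N = u ~ v → ∀ m → N ℕ.≤ m → 1ℚ + ½^ N < seq (sqDist (f u) (f v)) m
    isFar-mono : ∀ u v {a b} → a ℕ.≤ b → IsFar u v a → IsFar u v b
    isFar-mono u v a≤b far u~v m b≤m =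
      ℚ.≤-<-trans (ℚ.+-monoʳ-≤ 1ℚ (½^-anti (ℕ.≤⇒≤′ a≤b))) (far u~v m (ℕ.≤-trans a≤b b≤m))
    isFar : ∀ u v → ¬ ¬ ∃ (IsFar u v)
    isFar u v none with u ~? v
    ... | no  u≁v = none (0 , λ u~v → ⊥-elim (u≁v u~v))
    ... | yes u~v = ≰1⇒¬¬1< (sqDist (f u) (f v))
      (λ d²≤1 → proj₂ (Equivalence.from (f-spec u v λ u≡v → ~-irrefl u≡v u~v)
        (≤1⇒√≤1 (sqDist (f u) (f v)) d²≤1)) u~v)
      (λ (N , far) → none (N , λ _ → far))
    IsNear : ℕ → Fin n → Fin n → ℕ → Set
    IsNear N u v M = u ≢ v → ¬ u ~ v → ∀ m → M ℕ.≤ m → seq (sqDist (f u) (f v)) m ≤ 1ℚ + ½^ N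
    isNear-mono : ∀ N u v {a b} → a ℕ.≤ b → IsNear N u v a → IsNear N u v b
    isNear-mono N u v a≤b near u≢v u≁v m b≤m = near u≢v u≁v m (ℕ.≤-trans a≤b b≤m)
    isNear : ∀ N u v → ∃ (IsNear N u v)
    isNear N u v with u Fin.≟ v | u ~? v
    ... | yes u≡v | _       = 0 , λ u≢v → ⊥-elim (u≢v u≡v)
    ... | _       | yes u~v = 0 , λ _ u≁v → ⊥-elim (u≁v u~v)
    ... | no u≢v  | no u≁v  =
      let M , near = √≤1⇒≤1 (sqDist (f u) (f v)) (Equivalence.to (f-spec u v u≢v) (u≢v , u≁v)) (½^ N) (½^-pos N)
      in M , λ _ _ → near

-- Indices modulo n and the antihole of a cycle.

module _ {n} .{{_ : ℕ.NonZero n}} where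

  -- With equal remainders, comparing quotients gives j ≤ i or n + i ≤ j.
  %-injective-within : ∀ {i j} → i ℕ.< j → j ℕ.< n ℕ.+ i → i % n ≢ j % n
  %-injective-within {i} {j} i<j j<n+i i≡j with j / n ℕ.≤? i / n
  ... | yes j/n≤i/n = ℕ.<⇒≱ i<j (begin
    j                       ≡⟨ ℕ.m≡m%n+[m/n]*n j n ⟩
    j % n ℕ.+ (j / n) ℕ.* n ≤⟨ ℕ.+-mono-≤ (ℕ.≤-reflexive (sym i≡j)) (ℕ.*-monoˡ-≤ n j/n≤i/n) ⟩
    i % n ℕ.+ (i / n) ℕ.* n ≡⟨ ℕ.m≡m%n+[m/n]*n i n ⟨
    i                       ∎)
    where open ℕ.≤-Reasoning
  ... | no j/n≰i/n = ℕ.<⇒≱ j<n+i (begin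
    n ℕ.+ i                         ≡⟨ cong (n ℕ.+_) (ℕ.m≡m%n+[m/n]*n i n) ⟩
    n ℕ.+ (i % n ℕ.+ (i / n) ℕ.* n) ≡⟨ ℕ.+-assoc n (i % n) _ ⟨
    n ℕ.+ i % n ℕ.+ (i / n) ℕ.* n   ≡⟨ cong (ℕ._+ (i / n) ℕ.* n) (ℕ.+-comm n (i % n)) ⟩
    i % n ℕ.+ n ℕ.+ (i / n) ℕ.* n   ≡⟨ ℕ.+-assoc (i % n) n _ ⟩
    i % n ℕ.+ suc (i / n) ℕ.* n     ≤⟨ ℕ.+-mono-≤ (ℕ.≤-reflexive i≡j) (ℕ.*-monoˡ-≤ n (ℕ.≰⇒> j/n≰i/n)) ⟩
    j % n ℕ.+ (j / n) ℕ.* n         ≡⟨ ℕ.m≡m%n+[m/n]*n j n ⟨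
    j                               ∎)
    where open ℕ.≤-Reasoning

  toℕ-mod : ∀ i → toℕ (i mod n) ≡ i % n
  toℕ-mod i = Fin.toℕ-fromℕ< (ℕ.m%n<n i n)

  suc-%-% : ∀ i → suc (i % n) % n ≡ suc i % n
  suc-%-% i = begin
    suc (i % n) % n                       ≡⟨ ℕ.[m+kn]%n≡m%n (suc (i % n)) (i / n) n ⟨
    (suc (i % n) ℕ.+ (i / n) ℕ.* n) % n   ≡⟨ cong (λ j → suc j % n) (ℕ.m≡m%n+[m/n]*n i n) ⟨
    suc i % n                             ∎
    where open ≡-Reasoning

  Next-mod⇒≡ : ∀ i j → Next (i mod n) (j mod n) → suc i % n ≡ j % n
  Next-mod⇒≡ i j next = trans (sym (suc-%-% i)) (by next)
    where
    by : Next (i mod n) (j mod n) → suc (i % n) % n ≡ j % n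
    by (inj₁ 1+i≡j) = trans (cong (_% n) (subst₂ (λ a b → suc a ≡ b) (toℕ-mod i) (toℕ-mod j) 1+i≡j))
                        (ℕ.m%n%n≡m%n j n)
    by (inj₂ (1+i≡n , j≡0)) = trans (cong (_% n) (subst (λ a → suc a ≡ n) (toℕ-mod i) 1+i≡n))
                                (trans (ℕ.n%n≡0 n) (sym (trans (sym (toℕ-mod j)) j≡0)))

  Next-mod-suc : ∀ i → Next (i mod n) (suc i mod n)
  Next-mod-suc i with ℕ.m≤n⇒m<n∨m≡n (ℕ.m%n<n i n)
  ... | inj₁ 1+i<n = inj₁ (subst₂ (λ a b → suc a ≡ b) (sym (toℕ-mod i)) (sym (toℕ-mod (suc i)))
                       (trans (sym (ℕ.m<n⇒m%n≡m 1+i<n)) (suc-%-% i)))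
  ... | inj₂ 1+i≡n = inj₂ (trans (cong suc (toℕ-mod i)) 1+i≡n ,
                       trans (toℕ-mod (suc i)) (trans (sym (suc-%-% i)) (trans (cong (_% n) 1+i≡n) (ℕ.n%n≡0 n))))

  mod-≢ : ∀ {i j} → i ℕ.< j → j ℕ.< n ℕ.+ i → i mod n ≢ j mod n
  mod-≢ {i} {j} i<j j<n+i i≡j = %-injective-within i<j j<n+i
    (trans (sym (toℕ-mod i)) (trans (cong toℕ i≡j) (toℕ-mod j)))

  -- Unrolling the cycle along ℕ lets the walk run past n without wraparound cases.
  antihole : ∀ {r} (q : Fin n → Vector) → 2 ℕ.≤ n →
    let open Graph (cycle n) in
    (∀ u v → u ~ v → Far r (q u) (q v)) → (∀ u v → u ≢ v → ¬ u ~ v → Near r (q u) (q v)) →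
    Antihole n r (λ i → q (i mod n))
  antihole q 2≤n far near = record
    { periodic = λ i → cong q (Fin.toℕ-injective
        (trans (toℕ-mod (i ℕ.+ n)) (trans (ℕ.[m+n]%n≡m%n i n) (sym (toℕ-mod i)))))
    ; far = λ i → far _ _ (mod-≢ ℕ.≤-refl (ℕ.+-monoˡ-≤ i 2≤n) , inj₁ (Next-mod-suc i))
    ; near = λ i j 2+i≤j 2+j≤n+i → near _ _
        (mod-≢ (ℕ.<⇒≤ 2+i≤j) (ℕ.<⇒≤ 2+j≤n+i))
        (λ where
          (_ , inj₁ next) → %-injective-within 2+i≤j
            (ℕ.≤-trans (ℕ.<⇒≤ 2+j≤n+i) (ℕ.+-monoʳ-≤ n (ℕ.n≤1+n i))) (Next-mod⇒≡ i j next)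
          (_ , inj₂ next) → %-injective-within (ℕ.m≤n⇒m≤1+n (ℕ.<⇒≤ 2+i≤j)) 2+j≤n+i
            (sym (Next-mod⇒≡ j i next)))
    }

even-anticycle-non-UDG : ∀ s → let t = suc s in ¬ IsUDG (complement (cycle (6 ℕ.+ (t ℕ.+ t))))
even-anticycle-non-UDG s udg = rational-representation (cycle _) udg
  λ (r , q , far , near) → no-even-antihole (antihole q (ℕ.s≤s (ℕ.s≤s ℕ.z≤n)) far near)

-- Drawing the complement of a path on two parabolas.

≤-by : ∀ {p q d} → 0ℚ ≤ d → q ≡ p + d → p ≤ q
≤-by {p} {q} {d} 0≤d refl = subst (_≤ p + d) (ℚ.+-identityʳ p) (ℚ.+-monoʳ-≤ p 0≤d)

ι-+ : ∀ m n → ι (m ℕ.+ n) ≡ ι m + ι n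
ι-+ zero    n = sym (ℚ.+-identityˡ (ι n))
ι-+ (suc m) n = begin
  ι (suc (m ℕ.+ n))   ≡⟨ ι-suc (m ℕ.+ n) ⟩
  1ℚ + ι (m ℕ.+ n)    ≡⟨ cong (1ℚ +_) (ι-+ m n) ⟩
  1ℚ + (ι m + ι n)    ≡⟨ ℚ.+-assoc 1ℚ (ι m) (ι n) ⟨
  1ℚ + ι m + ι n      ≡⟨ cong (_+ ι n) (ι-suc m) ⟨
  ι (suc m) + ι n     ∎
  where open ≡-Reasoning

0≤ι : ∀ n → 0ℚ ≤ ι n
0≤ι zero    = ℚ.≤-refl
0≤ι (suc n) = subst (0ℚ ≤_) (sym (ι-suc n)) (ℚ.+-mono-≤ (ℚ.<⇒≤ 0<1) (0≤ι n))

ι-mono : ∀ {m n} → m ℕ.≤ n → ι m ≤ ι n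
ι-mono {m} {n} m≤n = ≤-by (0≤ι (n ℕ.∸ m)) (trans (cong ι (sym (ℕ.m+[n∸m]≡n m≤n))) (ι-+ m (n ℕ.∸ m)))

3ℚ : ℚ
3ℚ = 1ℚ + (1ℚ + 1ℚ)

-- The parabolas x = y² and x = 1 + 2η² - y², exchanged by a half-turn; hence the distance formulas
-- do not depend on which side comes first.
place : ℚ → Bool → ℚ → Vector
place η true  a = η * a * (η * a) , η * a
place η false a = 1ℚ + (η * η + η * η) - η * a * (η * a) , - (η * a)

same-side : ℚ → ℚ → ℚ → ℚ
same-side η a b =
  let z = η * a - η * b ; w = η * a + η * b in z * z + z * z * (w * w)

-- Up to sign the coordinate differences are 1 + ηy and η(a + b); the squares are regrouped to
-- isolate the gap b - a.
across : ℚ → ℚ → ℚ → ℚ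
across η a b =
  let y = η * (1ℚ + 1ℚ) - (η * (a * a) + η * (b * b))
  in 1ℚ + η * η * ((1ℚ + 3ℚ) - (b - a) * (b - a)) + η * y * (η * y)

place-same-side : ∀ η s a b → ∥ place η s a ⊖ place η s b ∥² ≡ same-side η a b
place-same-side η true a b = solve 3 (λ η a b →
  let z = η :* a :- η :* b ; w = η :* a :+ η :* b in
  ∥ (η :* a :* (η :* a) , η :* a) ⊖ₑ (η :* b :* (η :* b) , η :* b) ∥ₑ
    := z :* z :+ z :* z :* (w :* w)) refl η a b
place-same-side η false a b = solve 3 (λ η a b →
  let z = η :* a :- η :* b ; w = η :* a :+ η :* b
      c = con 1ℚ :+ (η :* η :+ η :* η) in
  ∥ (c :- η :* a :* (η :* a) , :- (η :* a)) ⊖ₑ (c :- η :* b :* (η :* b) , :- (η :* b)) ∥ₑ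
    := z :* z :+ z :* z :* (w :* w)) refl η a b

place-across : ∀ η s a b → ∥ place η s a ⊖ place η (not s) b ∥² ≡ across η a b
place-across η true a b = solve 3 (λ η a b →
  let y = η :* con (1ℚ + 1ℚ) :- (η :* (a :* a) :+ η :* (b :* b))
      c = con 1ℚ :+ (η :* η :+ η :* η) in
  ∥ (η :* a :* (η :* a) , η :* a) ⊖ₑ (c :- η :* b :* (η :* b) , :- (η :* b)) ∥ₑ
    := con 1ℚ :+ η :* η :* (con (1ℚ + 3ℚ) :- (b :- a) :* (b :- a)) :+ η :* y :* (η :* y)) refl η a b
place-across η false a b = solve 3 (λ η a b →
  let y = η :* con (1ℚ + 1ℚ) :- (η :* (a :* a) :+ η :* (b :* b))
      c = con 1ℚ :+ (η :* η :+ η :* η) in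
  ∥ (c :- η :* a :* (η :* a) , :- (η :* a)) ⊖ₑ (η :* b :* (η :* b) , η :* b) ∥ₑ
    := con 1ℚ :+ η :* η :* (con (1ℚ + 3ℚ) :- (b :- a) :* (b :- a)) :+ η :* y :* (η :* y)) refl η a b

square≤1 : ∀ {p} → - 1ℚ ≤ p → p ≤ 1ℚ → p * p ≤ 1ℚ
square≤1 {p} -1≤p p≤1 = ≤-by (0≤*0≤ (0≤q-p p≤1) (0≤q-p -1≤p))
  (solve 1 (λ p → con 1ℚ := p :* p :+ (con 1ℚ :- p) :* (p :- con (- 1ℚ))) refl p)

-- The smallness condition is η(2 + 2K + 2K²) ≤ 1, multiplied out. Its 2K part controls points on
-- one side, the rest controls `y` in `across`.
module Bounds {η K : ℚ} (0<η : 0ℚ < η)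
  (ηK≤1 : η * (1ℚ + 1ℚ) + (η * K + η * K + (η * (K * K) + η * (K * K))) ≤ 1ℚ) where

  Between : ℚ → Set
  Between a = 0ℚ ≤ a × a ≤ K

  private
    η* : ∀ {p} → 0ℚ ≤ p → 0ℚ ≤ η * p
    η* = 0≤*0≤ (ℚ.<⇒≤ 0<η)
    η*-mono : ∀ {p q} → p ≤ q → η * p ≤ η * q
    η*-mono = ℚ.*-monoˡ-≤-nonNeg η {{ℚ.nonNegative (ℚ.<⇒≤ 0<η)}}
    0≤η2 : 0ℚ ≤ η * (1ℚ + 1ℚ)
    0≤η2 = η* (ℚ.<⇒≤ (ℚ.+-mono-< 0<1 0<1))
    0≤ηK² : 0ℚ ≤ η * (K * K)
    0≤ηK² = η* (0≤p² K)
    ηa+ηb≤1 : ∀ {a b} → Between a → Between b → η * a + η * b ≤ 1ℚ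
    ηa+ηb≤1 (0≤a , a≤K) (0≤b , b≤K) = ℚ.≤-trans
      (ℚ.+-mono-≤ (η*-mono a≤K) (η*-mono b≤K))
      (ℚ.≤-trans (≤-by (ℚ.+-mono-≤ 0≤η2 (ℚ.+-mono-≤ 0≤ηK² 0≤ηK²))
        (solve 3 (λ t x y → t :+ (x :+ x :+ (y :+ y)) := x :+ x :+ (t :+ (y :+ y))) refl
          (η * (1ℚ + 1ℚ)) (η * K) (η * (K * K)))) ηK≤1)

  -- Both |w| and |2z| are at most 1, so the sum is at most 2z² = (2z)²/2 ≤ 1/2.
  same-side≤1 : ∀ {a b} → Between a → Between b → same-side η a b ≤ 1ℚ
  same-side≤1 {a} {b} a∈ b∈ = begin
    z * z + z * z * (w * w)    ≤⟨ ℚ.+-monoʳ-≤ (z * z)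
                                    (ℚ.*-monoˡ-≤-nonNeg (z * z) {{ℚ.nonNegative (0≤p² z)}} w²≤1) ⟩
    z * z + z * z * 1ℚ         ≡⟨ solve 1 (λ z → z :* z :+ z :* z :* con 1ℚ
                                    := con ½ :* ((z :+ z) :* (z :+ z))) refl z ⟩
    ½ * ((z + z) * (z + z))    ≤⟨ ℚ.*-monoˡ-≤-nonNeg ½ (square≤1 -1≤2z 2z≤1) ⟩
    ½ * 1ℚ                     ≤⟨ ℚ.≤ᵇ⇒≤ {½ * 1ℚ} {1ℚ} _ ⟩
    1ℚ                         ∎
    where
    open ℚ.≤-Reasoning
    z w : ℚ
    z = η * a - η * b
    w = η * a + η * b
    0≤ηa = η* (proj₁ a∈)
    0≤ηb = η* (proj₁ b∈)
    w²≤1 : w * w ≤ 1ℚ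
    w²≤1 = square≤1 (ℚ.≤-trans (ℚ.≤ᵇ⇒≤ {(- 1ℚ)} {0ℚ} _) (ℚ.+-mono-≤ 0≤ηa 0≤ηb)) (ηa+ηb≤1 a∈ b∈)
    2z≤1 : z + z ≤ 1ℚ
    2z≤1 = ℚ.≤-trans (≤-by (ℚ.+-mono-≤ 0≤ηb 0≤ηb)
      (solve 2 (λ x y → x :+ x := (x :- y) :+ (x :- y) :+ (y :+ y)) refl (η * a) (η * b))) (ηa+ηb≤1 a∈ a∈)
    -1≤2z : - 1ℚ ≤ z + z
    -1≤2z = ℚ.≤-trans (ℚ.neg-antimono-≤ (ηa+ηb≤1 b∈ b∈)) (≤-by (ℚ.+-mono-≤ 0≤ηa 0≤ηa)
      (solve 2 (λ x y → (x :- y) :+ (x :- y) := :- (y :+ y) :+ (x :+ x)) refl (η * a) (η * b)))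

  across-next : ∀ a → 1ℚ < across η a (1ℚ + a)
  across-next a = ℚ.<-≤-trans 1<1+3η² (≤-by (0≤p² (η * y))
    (solve 3 (λ η a y →
      con 1ℚ :+ η :* η :* (con (1ℚ + 3ℚ) :- (con 1ℚ :+ a :- a) :* (con 1ℚ :+ a :- a)) :+ η :* y :* (η :* y)
      := con 1ℚ :+ η :* η :* con 3ℚ :+ η :* y :* (η :* y)) refl η a y))
    where
    y : ℚ
    y = η * (1ℚ + 1ℚ) - (η * (a * a) + η * ((1ℚ + a) * (1ℚ + a)))
    1<1+3η² : 1ℚ < 1ℚ + η * η * 3ℚ
    1<1+3η² = ℚ.+-monoʳ-< 1ℚ {0ℚ} (*-pos (*-pos 0<η 0<η) (ℚ.positive⁻¹ 3ℚ))

  across-far : ∀ {a b c} → Between a → Between b → 0ℚ ≤ c → b ≡ (3ℚ + c) + a → across η a b ≤ 1ℚ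
  across-far {a} {b} {c} (0≤a , a≤K) (0≤b , b≤K) 0≤c b≡ = ≤-by
    -- The slack is η²((3 + c)² - 4 - y²), and the second factor equals 4 + c(6 + c) + (1 - y²).
    (0≤*0≤ (0≤p² η) (ℚ.+-mono-≤ (ℚ.+-mono-≤ (ℚ.≤ᵇ⇒≤ {0ℚ} {1ℚ + 3ℚ} _)
       (0≤*0≤ 0≤c (ℚ.+-mono-≤ (ℚ.≤ᵇ⇒≤ {0ℚ} {3ℚ + 3ℚ} _) 0≤c))) (0≤q-p y²≤1)))
    (subst (λ b → 1ℚ ≡ 1ℚ + η * η * ((1ℚ + 3ℚ) - (b - a) * (b - a)) + η * y * (η * y)
        + η * η * ((1ℚ + 3ℚ) + c * ((3ℚ + 3ℚ) + c) + (1ℚ - y * y))) (sym b≡)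
      (solve 4 (λ η a c y → let d = con 3ℚ :+ c :+ a :- a in
        con 1ℚ := con 1ℚ :+ η :* η :* (con (1ℚ + 3ℚ) :- d :* d) :+ η :* y :* (η :* y)
        :+ η :* η :* (con (1ℚ + 3ℚ) :+ c :* (con (3ℚ + 3ℚ) :+ c) :+ (con 1ℚ :- y :* y))) refl η a c y))
    where
    s t y : ℚ
    s = η * (a * a) + η * (b * b)
    t = η * (1ℚ + 1ℚ)
    y = t - s
    0≤s : 0ℚ ≤ s
    0≤s = ℚ.+-mono-≤ (η* (0≤p² a)) (η* (0≤p² b))
    0≤K : 0ℚ ≤ K
    0≤K = ℚ.≤-trans 0≤a a≤K
    s≤ : s ≤ η * (K * K) + η * (K * K)
    s≤ = ℚ.+-mono-≤ (η*-mono (*-mono-≤-nonNeg 0≤a a≤K)) (η*-mono (*-mono-≤-nonNeg 0≤b b≤K))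
    t+s≤1 : t + s ≤ 1ℚ
    t+s≤1 = ℚ.≤-trans (ℚ.+-monoʳ-≤ t s≤) (ℚ.≤-trans
      (≤-by (ℚ.+-mono-≤ (η* 0≤K) (η* 0≤K))
        (solve 3 (λ t x y → t :+ (x :+ x :+ (y :+ y)) := t :+ (y :+ y) :+ (x :+ x)) refl
          t (η * K) (η * (K * K)))) ηK≤1)
    y²≤1 : y * y ≤ 1ℚ
    y²≤1 = square≤1
      (ℚ.≤-trans (ℚ.neg-antimono-≤ t+s≤1) (≤-by (ℚ.+-mono-≤ 0≤η2 0≤η2)
        (solve 2 (λ t s → t :- s := :- (t :+ s) :+ (t :+ t)) refl t s)))
      (ℚ.≤-trans (≤-by (ℚ.+-mono-≤ 0≤s 0≤s)
        (solve 2 (λ t s → t :+ s := t :- s :+ (s :+ s)) refl t s)) t+s≤1)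

even? : ℕ → Bool
even? zero    = true
even? (suc n) = not (even? n)

module Antipath {η : ℚ} {N : ℕ} (0<η : 0ℚ < η)
  (ηN≤1 : η * (1ℚ + 1ℚ) + (η * ι N + η * ι N + (η * (ι N * ι N) + η * (ι N * ι N))) ≤ 1ℚ) where

  open Bounds {η} {ι N} 0<η ηN≤1
  g : ℕ → Vector
  g i = place η (even? i) (ι i)
  between : ∀ {i} → i ℕ.≤ N → Between (ι i)
  between {i} i≤N = 0≤ι i , ι-mono i≤N
  next : ∀ i → Far 1ℚ (g i) (g (suc i))
  next i = subst (1ℚ <_) (sym (trans (place-across η (even? i) (ι i) (ι (suc i)))
    (cong (across η (ι i)) (ι-suc i)))) (across-next (ι i))
  same : ∀ i j → i ℕ.≤ N → j ℕ.≤ N → even? j ≡ even? i → Near 1ℚ (g i) (g j)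
  same i j i≤N j≤N e = subst (λ s → ∥ g i ⊖ place η s (ι j) ∥² ≤ 1ℚ) (sym e)
    (subst (_≤ 1ℚ) (sym (place-same-side η (even? i) (ι i) (ι j))) (same-side≤1 (between i≤N) (between j≤N)))
  opposite : ∀ i d → 3 ℕ.+ d ℕ.+ i ℕ.≤ N → even? (3 ℕ.+ d ℕ.+ i) ≡ not (even? i) →
             Near 1ℚ (g i) (g (3 ℕ.+ d ℕ.+ i))
  opposite i d j≤N e = subst (λ s → ∥ g i ⊖ place η s (ι (3 ℕ.+ d ℕ.+ i)) ∥² ≤ 1ℚ) (sym e)
    (subst (_≤ 1ℚ) (sym (place-across η (even? i) (ι i) (ι (3 ℕ.+ d ℕ.+ i))))
      (across-far (between (ℕ.≤-trans (ℕ.m≤n+m i (3 ℕ.+ d)) j≤N)) (between j≤N) (0≤ι d)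
        (trans (ι-+ (3 ℕ.+ d) i) (cong (_+ ι i) (ι-+ 3 d)))))
  apart : ∀ i d → 2 ℕ.+ d ℕ.+ i ℕ.≤ N → Near 1ℚ (g i) (g (2 ℕ.+ d ℕ.+ i))
  apart i d j≤N with even? (2 ℕ.+ d ℕ.+ i) Bool.≟ even? i
  ... | yes e = same i (2 ℕ.+ d ℕ.+ i) (ℕ.≤-trans (ℕ.m≤n+m i (2 ℕ.+ d)) j≤N) j≤N e
  -- A gap of 2 preserves parity, so opposite parity forces a gap of at least 3.
  apart i zero    j≤N | no e = ⊥-elim (e (not-involutive (even? i)))
  apart i (suc d) j≤N | no e = opposite i d j≤N (¬-not e)
  far : ∀ i j → j ℕ.≤ N → 2 ℕ.+ i ℕ.≤ j → Near 1ℚ (g i) (g j)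
  far i j j≤N 2+i≤j = subst (λ k → Near 1ℚ (g i) (g k)) eq (apart i d (subst (ℕ._≤ N) (sym eq) j≤N))
    where
    d : ℕ
    d = j ℕ.∸ (2 ℕ.+ i)
    eq : 2 ℕ.+ d ℕ.+ i ≡ j
    eq = trans (cong (2 ℕ.+_) (ℕ.+-comm d i)) (ℕ.m+[n∸m]≡n 2+i≤j)

antipath : ∀ N → ∃[ g ] (∀ i → Far 1ℚ (g i) (g (suc i))) ×
  (∀ i j → j ℕ.≤ N → 2 ℕ.+ i ℕ.≤ j → Near 1ℚ (g i) (g j))
antipath N = with-scale (shrink {B} 0<B 0<1)
  where
  K B : ℚ
  K = ι N
  -- The coefficient of η in the smallness condition; `shrink` returns η with B * η = ½.
  B = (1ℚ + 1ℚ) + (K + K + (K * K + K * K))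
  0≤K : 0ℚ ≤ K
  0≤K = 0≤ι N
  0<B : 0ℚ < B
  0<B = ℚ.+-mono-<-≤ (ℚ.+-mono-< 0<1 0<1)
    (ℚ.+-mono-≤ (ℚ.+-mono-≤ 0≤K 0≤K) (ℚ.+-mono-≤ (0≤p² K) (0≤p² K)))
  with-scale : ∃[ η ] 0ℚ < η × B * η ≡ ½ * 1ℚ → _
  with-scale (η , 0<η , Bη≡½) = g , next , far
    where
    open Antipath {η} {N} 0<η (ℚ.≤-trans (ℚ.≤-reflexive (trans
      (solve 2 (λ η K → η :* con (1ℚ + 1ℚ) :+ (η :* K :+ η :* K :+ (η :* (K :* K) :+ η :* (K :* K)))
        := (con (1ℚ + 1ℚ) :+ (K :+ K :+ (K :* K :+ K :* K))) :* η) refl η K)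
      Bη≡½)) (ℚ.≤ᵇ⇒≤ {½ * 1ℚ} {1ℚ} _))

-- Rational drawings as unit disk representations.

fromℚ-cancel-≤ : ∀ {p q} → fromℚ p ≤ℝ fromℚ q → p ≤ q
fromℚ-cancel-≤ {p} {q} p≤q = ℚ.≮⇒≥ λ q<p →
  let 0<d = half-pos (0<q-p q<p)
      N , p≤q+d = p≤q (½ * (p - q)) 0<d
  in ℚ.<-irrefl refl (begin-strict
    p                               ≤⟨ p≤q+d N ℕ.≤-refl ⟩
    q + ½ * (p - q)                 <⟨ ℚ.+-monoʳ-< q (<-step (sym (ℚ.+-identityʳ (½ * (p - q))))
                                         (ℚ.+-monoʳ-< (½ * (p - q)) 0<d)) ⟩
    q + (½ * (p - q) + ½ * (p - q)) ≡⟨ cong (q +_) (halves (p - q)) ⟩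
    q + (p - q)                     ≡⟨ solve 2 (λ p q → q :+ (p :- q) := p) refl p q ⟩
    p                               ∎)
  where open ℚ.≤-Reasoning

fromℚ-mono-≤ : ∀ {p q} → p ≤ q → fromℚ p ≤ℝ fromℚ q
fromℚ-mono-≤ {p} {q} p≤q ε 0<ε = 0 , λ _ _ →
  ℚ.≤-trans p≤q (≤-by (ℚ.<⇒≤ 0<ε) refl)

rational⇒UDG : ∀ {n} (G : Graph n) (q : Fin n → Vector) → let open Graph G in
  (∀ u v → u ~ v → Near 1ℚ (q u) (q v)) → (∀ u v → u ≢ v → ¬ u ~ v → Far 1ℚ (q u) (q v)) → IsUDG G
rational⇒UDG G q near far = (λ u → point (q u)) , λ u v u≢v → mk⇔
  (λ u~v → ≤1⇒√≤1 (sqDist (point (q u)) (point (q v))) (fromℚ-mono-≤ (near u v u~v)))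
  (λ d≤1 → decidable-stable (u ~? v) λ u≁v → ℚ.<-irrefl refl (ℚ.<-≤-trans (far u v u≢v u≁v)
    (fromℚ-cancel-≤ (√≤1⇒≤1 (sqDist (point (q u)) (point (q v))) d≤1))))
  where
  open Graph G
  point : Vector → Point
  point (x , y) = fromℚ x , fromℚ y

-- The cycle without a vertex, read as a path.

module _ {n} (v : Fin n) where

  -- Increases by one along the path left after removing v; it starts at 1 + v
  -- rather than 0 so that no subtraction is needed.
  label : Fin n → ℕ
  label u with toℕ v ℕ.<? toℕ u
  ... | yes _ = toℕ u
  ... | no  _ = n ℕ.+ toℕ u

  label≤2n : ∀ u → label u ℕ.≤ n ℕ.+ n
  label≤2n u with toℕ v ℕ.<? toℕ u
  ... | yes _ = ℕ.≤-trans (ℕ.<⇒≤ (Fin.toℕ<n u)) (ℕ.m≤m+n n n)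
  ... | no  _ = ℕ.+-monoʳ-≤ n (ℕ.<⇒≤ (Fin.toℕ<n u))

  label-injective : ∀ u w → label u ≡ label w → u ≡ w
  label-injective u w eq with toℕ v ℕ.<? toℕ u | toℕ v ℕ.<? toℕ w
  ... | yes _ | yes _ = Fin.toℕ-injective eq
  ... | yes _ | no  _ = ⊥-elim (ℕ.<⇒≱ (Fin.toℕ<n u) (subst (n ℕ.≤_) (sym eq) (ℕ.m≤m+n n (toℕ w))))
  ... | no  _ | yes _ = ⊥-elim (ℕ.<⇒≱ (Fin.toℕ<n w) (subst (n ℕ.≤_) eq (ℕ.m≤m+n n (toℕ u))))
  ... | no  _ | no  _ = Fin.toℕ-injective (ℕ.+-cancelˡ-≡ n _ _ eq)

  -- Steps on one side of `v` are ordinary, and the wraparound from n - 1 to 0 becomes the step from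
  -- n - 1 to n. The other cases contradict the order or force u ≡ v.
  Next⇒label : ∀ {u w} → u ≢ v → w ≢ v → Next u w → suc (label u) ≡ label w
  Next⇒label {u} {w} u≢v w≢v next with toℕ v ℕ.<? toℕ u | toℕ v ℕ.<? toℕ w
  Next⇒label _ _ (inj₁ eq) | yes _ | yes _ = eq
  Next⇒label _ _ (inj₁ eq) | yes v<u | no v≮w = ⊥-elim (v≮w (subst (_ ℕ.<_) eq (ℕ.m≤n⇒m≤1+n v<u)))
  Next⇒label u≢v _ (inj₁ eq) | no v≮u | yes v<w =
    ⊥-elim (u≢v (Fin.toℕ-injective (ℕ.≤-antisym (ℕ.≮⇒≥ v≮u) (ℕ.≤-pred (subst (suc (toℕ v) ℕ.≤_) (sym eq) v<w)))))
  Next⇒label {u} _ _ (inj₁ eq) | no _ | no _ = trans (sym (ℕ.+-suc n (toℕ u))) (cong (n ℕ.+_) eq)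
  Next⇒label _ _ (inj₂ (_ , w≡0)) | _ | yes v<w = ⊥-elim (ℕ.n≮0 (subst (_ ℕ.<_) w≡0 v<w))
  Next⇒label _ _ (inj₂ (1+u≡n , w≡0)) | yes _ | no _ =
    trans 1+u≡n (trans (sym (ℕ.+-identityʳ n)) (cong (n ℕ.+_) (sym w≡0)))
  Next⇒label u≢v _ (inj₂ (1+u≡n , _)) | no v≮u | no _ = ⊥-elim (u≢v (Fin.toℕ-injective
    (ℕ.≤-antisym (ℕ.≮⇒≥ v≮u) (ℕ.≤-pred (subst (suc (toℕ v) ℕ.≤_) (sym 1+u≡n) (Fin.toℕ<n v))))))

  label⇒Next : ∀ u w → suc (label u) ≡ label w → Next u w
  label⇒Next u w eq with toℕ v ℕ.<? toℕ u | toℕ v ℕ.<? toℕ w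
  ... | yes _ | yes _ = inj₁ eq
  ... | yes _ | no  _ = inj₂ (ℕ.≤-antisym (Fin.toℕ<n u) (subst (n ℕ.≤_) (sym eq) (ℕ.m≤m+n n (toℕ w))) ,
      ℕ.n≤0⇒n≡0 (ℕ.+-cancelˡ-≤ n _ _ (subst₂ ℕ._≤_ eq (sym (ℕ.+-identityʳ n)) (Fin.toℕ<n u))))
  ... | no  _ | yes _ = ⊥-elim (ℕ.<⇒≱ (Fin.toℕ<n w)
      (subst (n ℕ.≤_) eq (ℕ.m≤n⇒m≤1+n (ℕ.m≤m+n n (toℕ u)))))
  ... | no  _ | no  _ = inj₁ (ℕ.+-cancelˡ-≡ n _ _ (trans (ℕ.+-suc n (toℕ u)) eq))

  open Graph (cycle n) using (_~_)

  module Drawing (g : ℕ → Vector) (g-far : ∀ i → Far 1ℚ (g i) (g (suc i)))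
    (g-near : ∀ i j → j ℕ.≤ n ℕ.+ n → 2 ℕ.+ i ℕ.≤ j → Near 1ℚ (g i) (g j)) where

    draw : Fin n → Vector
    draw u = g (label u)

    draw-far : ∀ u w → u ≢ v → w ≢ v → u ~ w → Far 1ℚ (draw u) (draw w)
    draw-far u w u≢v w≢v (_ , inj₁ u→w) =
      subst (λ k → Far 1ℚ (g (label u)) (g k)) (Next⇒label u≢v w≢v u→w) (g-far (label u))
    draw-far u w u≢v w≢v (_ , inj₂ w→u) = Far-sym (draw w) (draw u)
      (subst (λ k → Far 1ℚ (g (label w)) (g k)) (Next⇒label w≢v u≢v w→u) (g-far (label w)))
      where
      Far-sym : ∀ a b → Far 1ℚ a b → Far 1ℚ b a
      Far-sym a b = subst (1ℚ <_) (∥⊖∥²-comm a b)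

    -- The labels are distinct and not consecutive, since consecutive labels belong to neighbours on
    -- the cycle.
    draw-near : ∀ u w → u ≢ w → ¬ u ~ w → Near 1ℚ (draw u) (draw w)
    draw-near u w u≢w u≁w with ℕ.<-cmp (label u) (label w)
    ... | tri< u<w _ _ = g-near (label u) (label w) (label≤2n w)
      (ℕ.≤∧≢⇒< u<w λ eq → u≁w (u≢w , inj₁ (label⇒Next u w eq)))
    ... | tri≈ _ eq _ = ⊥-elim (u≢w (label-injective u w eq))
    ... | tri> _ _ w<u = Near-sym {a = draw w} {draw u} (g-near (label w) (label u) (label≤2n u)
      (ℕ.≤∧≢⇒< w<u λ eq → u≁w (u≢w , inj₂ (label⇒Next w u eq))))

-- Proper induced subgraphs and the theorem.

element-∈ : ∀ {n} (S : Subset n) i → element S i ∈ S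
element-∈ (outside ∷ S) i       = there (element-∈ S i)
element-∈ (inside  ∷ S) zero    = here
element-∈ (inside  ∷ S) (suc i) = there (element-∈ S i)

element-injective : ∀ {n} (S : Subset n) i j → element S i ≡ element S j → i ≡ j
element-injective (outside ∷ S) i       j       eq = element-injective S i j (Fin.suc-injective eq)
element-injective (inside  ∷ S) zero    zero    eq = refl
element-injective (inside  ∷ S) (suc i) (suc j) eq = cong suc (element-injective S i j (Fin.suc-injective eq))

proper-anticycle-UDG : ∀ n (S : Subset n) → S ⊂ ⊤ → IsUDG (induced (complement (cycle n)) S)
proper-anticycle-UDG n S (_ , v , _ , v∉S) =
  -- `n + n` bounds every label, and `v` is a vertex missing from `S`.
  let g , g-far , g-near = antipath (n ℕ.+ n)
      open Drawing v g g-far g-near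
  in rational⇒UDG (induced (complement (cycle n)) S) (draw ∘ element S)
    (λ i j (u≢w , u≁w) → draw-near (element S i) (element S j) u≢w u≁w)
    (λ i j i≢j ¬near → draw-far (element S i) (element S j) (≢v i) (≢v j)
      (decidable-stable (element S i ~? element S j) λ u≁w →
        ¬near ((λ eq → i≢j (element-injective S i j eq)) , u≁w)))
  where
  open Graph (cycle n)
  ≢v : ∀ i → element S i ≢ v
  ≢v i eq = v∉S (subst (_∈ S) eq (element-∈ S i))

-- Matches k = 4 + s with the cycle length 6 + 2t of the walk.
2[4+s] : ∀ s → let t = suc s in 2 ℕ.* (4 ℕ.+ s) ≡ 6 ℕ.+ (t ℕ.+ t)
2[4+s] s = cong (4 ℕ.+_) (trans (cong (s ℕ.+_) (cong (4 ℕ.+_) (ℕ.+-identityʳ s)))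
  (trans (ℕ.+-suc s (3 ℕ.+ s)) (cong suc (trans (ℕ.+-suc s (2 ℕ.+ s)) (cong suc (ℕ.+-suc s (suc s)))))))

theorem7 : (k : ℕ) → 4 ℕ.≤ k → IsMinimalNonUDG (complement (cycle (2 ℕ.* k)))
theorem7 k 4≤k = non-UDG , proper-anticycle-UDG (2 ℕ.* k)
  where
  s : ℕ
  s = k ℕ.∸ 4
  non-UDG : ¬ IsUDG (complement (cycle (2 ℕ.* k)))
  non-UDG = subst (λ n → ¬ IsUDG (complement (cycle n)))
    (trans (sym (2[4+s] s)) (cong (2 ℕ.*_) (ℕ.m+[n∸m]≡n 4≤k)))
    (even-anticycle-non-UDG s)
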